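{- Let $q>2$ be a prime power, $n$ a positive integer and $F=\mathbb{F}_{q^{2n+1}}$. Let $\alpha=-1$ if $q$ is odd and let $\alpha$ be any element of $\mathbb{F}_q\setminus\{0,1\}$ if $q$ is even. Consider the projective space $\mathrm{PG}(4n+1,q)$ whose points are the $1$-dimensional $\mathbb{F}_q$-subspaces of the $\mathbb{F}_q$-vector space $F\times F$; write $P(a,b)$ for the point spanned by $(a,b)\ne(0,0)$. For $\omega\in F^*$ let $\mathcal{V}_\omega=\{P(x^2,\omega x^{q+1}):x\in F^*\}$. Then every point of $\mathrm{PG}(4n+1,q)\setminus(\mathcal{V}_1\cup\mathcal{V}_\alpha)$ lies on at least one line joining a point of $\mathcal{V}_1$ and a point of $\mathcal{V}_\alpha$.
   Context: Lines of the projective space are the $2$-dimensional $\mathbb{F}_q$-subspaces of $F\times F$. -}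

module Defs where

open import Level using (Level; _⊔_; suc)
open import Data.Nat using (ℕ; zero) renaming (suc to sucℕ)
open import Data.Nat.Primality using (Prime)
open import Data.Fin using (Fin)
open import Data.Product using (Σ; ∃; _×_; _,_)
open import Relation.Binary.PropositionalEquality using (_≡_)
open import Relation.Nullary using (¬_)
open import Algebra.Bundles using (CommutativeRing)

record Field (c ℓ : Level) : Set (suc (c ⊔ ℓ)) where
  field
    commRing : CommutativeRing c ℓ
  open CommutativeRing commRing public
  field
    1≉0 : ¬ (1# ≈ 0#)
    inverse : ∀ x → ¬ (x ≈ 0#) → ∃ λ y → x * y ≈ 1#

IsPrimePower : ℕ → Set
IsPrimePower q = Σ ℕ λ p → Σ ℕ λ k → Prime p × (q ≡ p Data.Nat.^ sucℕ k)

module FieldDefs {c ℓ} (K : Field c ℓ) where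
  open Field K

  pow : Carrier → ℕ → Carrier
  pow x zero = 1#
  pow x (sucℕ m) = x * pow x m

  HasCardinality : ℕ → Set (c ⊔ ℓ)
  HasCardinality N = Σ (Fin N → Carrier) λ e →
    (∀ i j → e i ≈ e j → i ≡ j) × (∀ x → ∃ λ i → e i ≈ x)

  -- the subfield F_q of F = F_{q^m}: the elements fixed by x ↦ x^q
  InFq : ℕ → Carrier → Set ℓ
  InFq q x = pow x q ≈ x

  NonZeroPair : Carrier → Carrier → Set ℓ
  NonZeroPair a b = ¬ (a ≈ 0# × b ≈ 0#)

  -- P(a,b) ∈ V_ω = { P(x², ω x^{q+1}) : x ∈ F* }, i.e. (a,b) = c·(x², ω x^{q+1})
  -- for some x ∈ F* and some c ∈ F_q*
  InV : ℕ → Carrier → Carrier → Carrier → Set (c ⊔ ℓ)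
  InV q ω a b = Σ Carrier λ x → Σ Carrier λ t →
    ¬ (x ≈ 0#) × InFq q t × ¬ (t ≈ 0#) ×
    (a ≈ t * pow x 2) × (b ≈ t * (ω * pow x (sucℕ q)))

  -- P(a,b) lies on the line joining a point P(x², x^{q+1}) of V_1 and a point
  -- P(y², α y^{q+1}) of V_α: (a,b) is an F_q-linear combination of these vectors
  OnSecant : ℕ → Carrier → Carrier → Carrier → Set (c ⊔ ℓ)
  OnSecant q α a b = Σ Carrier λ x → Σ Carrier λ y → Σ Carrier λ s → Σ Carrier λ t →
    ¬ (x ≈ 0#) × ¬ (y ≈ 0#) × InFq q s × InFq q t ×
    (a ≈ (s * pow x 2) + (t * pow y 2)) ×
    (b ≈ (s * pow x (sucℕ q)) + (t * (α * pow y (sucℕ q))))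

{-# OPTIONS --safe #-}

-- Both equations are solved explicitly. Let Q = q^(2n+1), so that q + 1 divides Q + 1 and every
-- square z² of F is the (q+1)-st power of z^((Q+1)/(q+1)).
-- For q even take s = t = 1 and y = x + √a; after a translation of x the second equation becomes
-- z^(q+1) = w, which is solvable because w is a square.
-- For q odd the problem is governed by the roots W of W² - 2 b W + a^(q+1). As (Q-1)/(q-1) is odd,
-- every element of F is a square up to a factor in F_q. If the discriminant D is a square, then
-- W = s u^(q+1), and the solution is found from u = x + y. Otherwise W lies in F[√D] and, by an
-- explicit form of Hilbert 90, W / a is a (q-1)-st power u^(q-1) there; x and y are the coordinates
-- of u, up to scaling.
module Submission where

open import Defs
open import Level using (Level; _⊔_)
open import Algebra.Bundles using (AbelianGroup; CommutativeRing)
import Algebra.Construct.DirectProduct as DirectProduct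
open import Data.Empty using (⊥-elim)
open import Data.Fin using (Fin; zero; suc; fromℕ; inject₁; punchIn)
import Data.Fin.Permutation as Perm
open import Data.Fin.Properties using (any?; punchInᵢ≢i; toℕ<n; toℕ-fromℕ; toℕ-inject₁) renaming (_≟_ to _≟ᶠ_)
open import Data.Integer as ℤ using (ℤ; +_; -[1+_])
import Data.Integer.Properties as ℤ
open import Data.Maybe using (Maybe; just; nothing)
open import Data.Nat as ℕ using (ℕ; zero; suc)
open import Data.Nat.Combinatorics using (_C_; nCn≡1; nCk+nC[k+1]≡[n+1]C[k+1])
open import Data.Nat.DivMod using (m≡m%n+[m/n]*n)
open import Data.Nat.Divisibility using (_∣_; divides; m∣m*n; >⇒∤)
open import Data.Nat.Primality using (Prime; prime[2]; euclidsLemma; prime⇒irreducible; prime⇒nonZero)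
import Data.Nat.Properties as ℕ
import Data.Nat.Tactic.RingSolver as ℕ-Ring
open import Data.Product using (∃; ∃₂; _×_; _,_; proj₁; proj₂)
open import Data.Sign as Sign using (Sign)
open import Data.Sum using (_⊎_; inj₁; inj₂)
open import Function using (_∘_)
import Relation.Binary.Reasoning.Setoid as SetoidReasoning
open import Relation.Binary.PropositionalEquality as ≡ using (_≡_; _≢_)
open import Relation.Nullary using (¬_; Dec; yes; no)

-- The quadratic for odd q arises as follows. Suppose D is a non-square of F and write D = ν ε² with
-- ν in F_q. For θ = δ / ε, θ² = ν is a non-square of F_q, hence θ^q = -θ. If u = x + y θ with x, y
-- in F, then u ū = x² - ν y², while the first coordinate of u^q ū is x^(q+1) + ν y^(q+1). This
-- change of sign is the one that t = -s ν and α = -1 produce, so the two equations say that s u ū =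
-- a and that s u^q ū has first coordinate b. With s in F_q, the element s u^q ū then has trace 2 b
-- and norm (s u ū)^(q+1) = a^(q+1): it is a root of W² - 2 b W + a^(q+1). Solving the equations
-- thus means prescribing this root and recovering u from the ratio W / a = u^(q-1). The oddness of
-- 2n+1 enters through two facts about exponents: q + 1 divides Q + 1, and (Q - 1) / (q - 1) is odd.
-- The extension F[δ] is used as a commutative ring of pairs; cancellation in it comes from the
-- norm, and its Frobenius map from Euler's criterion in F.

module IntegerCoefficients {c ℓ} (R : CommutativeRing c ℓ) where
  open CommutativeRing R
  open import Algebra.Properties.Ring ring
  open import Algebra.Properties.Semiring.Mult.TCOptimised semiring
    using (×-homo-+; ×1-homo-*; 1+×) renaming (_×_ to _·_)
  open import Algebra.Solver.Ring.AlmostCommutativeRing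
  open import Relation.Binary.Reasoning.Setoid setoid

  ⟦_⟧ℤ : ℤ → Carrier
  ⟦ + n ⟧ℤ      = n · 1#
  ⟦ -[1+ n ] ⟧ℤ = - (suc n · 1#)

  ⟦m⊖n⟧ : ∀ m n → ⟦ m ℤ.⊖ n ⟧ℤ ≈ m · 1# - n · 1#
  ⟦m⊖n⟧ zero    zero    = sym (-‿inverseʳ 0#)
  ⟦m⊖n⟧ zero    (suc n) = sym (+-identityˡ _)
  ⟦m⊖n⟧ (suc m) zero    = sym (trans (+-congˡ -0#≈0#) (+-identityʳ _))
  ⟦m⊖n⟧ (suc m) (suc n) = begin
    ⟦ suc m ℤ.⊖ suc n ⟧ℤ                ≡⟨ ≡.cong ⟦_⟧ℤ (ℤ.[1+m]⊖[1+n]≡m⊖n m n) ⟩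
    ⟦ m ℤ.⊖ n ⟧ℤ                        ≈⟨ ⟦m⊖n⟧ m n ⟩
    m · 1# - n · 1#                     ≈⟨ +-congʳ (+-identityʳ _) ⟨
    (m · 1# + 0#) - n · 1#              ≈⟨ +-congʳ (+-congˡ (-‿inverseʳ 1#)) ⟨
    (m · 1# + (1# - 1#)) - n · 1#       ≈⟨ +-congʳ (+-assoc _ _ _) ⟨
    ((m · 1# + 1#) - 1#) - n · 1#       ≈⟨ +-assoc _ _ _ ⟩
    (m · 1# + 1#) + (- 1# - n · 1#)     ≈⟨ +-cong (+-comm _ _) (-‿+-comm _ _) ⟩
    (1# + m · 1#) - (1# + n · 1#)       ≈⟨ +-cong (1+× m 1#) (-‿cong (1+× n 1#)) ⟨
    suc m · 1# - suc n · 1#             ∎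

  ⟦⟧-homo-+ : ∀ i j → ⟦ i ℤ.+ j ⟧ℤ ≈ ⟦ i ⟧ℤ + ⟦ j ⟧ℤ
  ⟦⟧-homo-+ (+ m)    (+ n)    = ×-homo-+ 1# m n
  ⟦⟧-homo-+ (+ m)    -[1+ n ] = ⟦m⊖n⟧ m (suc n)
  ⟦⟧-homo-+ -[1+ m ] (+ n)    = trans (⟦m⊖n⟧ n (suc m)) (+-comm _ _)
  ⟦⟧-homo-+ -[1+ m ] -[1+ n ] = begin
    - (suc (suc (m ℕ.+ n)) · 1#)    ≡⟨ ≡.cong (λ k → - (suc k · 1#)) (≡.sym (ℕ.+-suc m n)) ⟩
    - ((suc m ℕ.+ suc n) · 1#)      ≈⟨ -‿cong (×-homo-+ 1# (suc m) (suc n)) ⟩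
    - (suc m · 1# + suc n · 1#)     ≈⟨ -‿+-comm _ _ ⟨
    - (suc m · 1#) - (suc n · 1#)   ∎

  ⟦-◃n⟧ : ∀ n → ⟦ Sign.- ℤ.◃ n ⟧ℤ ≈ - (n · 1#)
  ⟦-◃n⟧ zero    = sym -0#≈0#
  ⟦-◃n⟧ (suc n) = refl

  ⟦⟧-homo-* : ∀ i j → ⟦ i ℤ.* j ⟧ℤ ≈ ⟦ i ⟧ℤ * ⟦ j ⟧ℤ
  ⟦⟧-homo-* (+ m)    (+ n)    = begin
    ⟦ Sign.+ ℤ.◃ m ℕ.* n ⟧ℤ   ≡⟨ ≡.cong ⟦_⟧ℤ (ℤ.+◃n≡+n (m ℕ.* n)) ⟩
    (m ℕ.* n) · 1#            ≈⟨ ×1-homo-* m n ⟩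
    (m · 1#) * (n · 1#)       ∎
  ⟦⟧-homo-* (+ m)    -[1+ n ] = begin
    ⟦ Sign.- ℤ.◃ m ℕ.* suc n ⟧ℤ  ≈⟨ ⟦-◃n⟧ (m ℕ.* suc n) ⟩
    - ((m ℕ.* suc n) · 1#)       ≈⟨ -‿cong (×1-homo-* m (suc n)) ⟩
    - ((m · 1#) * (suc n · 1#))  ≈⟨ -‿distribʳ-* _ _ ⟩
    (m · 1#) * - (suc n · 1#)    ∎
  ⟦⟧-homo-* -[1+ m ] (+ n)    = begin
    ⟦ Sign.- ℤ.◃ suc m ℕ.* n ⟧ℤ  ≈⟨ ⟦-◃n⟧ (suc m ℕ.* n) ⟩
    - ((suc m ℕ.* n) · 1#)       ≈⟨ -‿cong (×1-homo-* (suc m) n) ⟩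
    - ((suc m · 1#) * (n · 1#))  ≈⟨ -‿distribˡ-* _ _ ⟩
    - (suc m · 1#) * (n · 1#)    ∎
  ⟦⟧-homo-* -[1+ m ] -[1+ n ] = begin
    (suc m ℕ.* suc n) · 1#           ≈⟨ ×1-homo-* (suc m) (suc n) ⟩
    (suc m · 1#) * (suc n · 1#)      ≈⟨ -‿involutive _ ⟨
    - - ((suc m · 1#) * (suc n · 1#)) ≈⟨ -‿cong (-‿distribʳ-* _ _) ⟩
    - ((suc m · 1#) * - (suc n · 1#)) ≈⟨ -‿distribˡ-* _ _ ⟩
    - (suc m · 1#) * - (suc n · 1#)  ∎

  ⟦⟧-homo-‿ : ∀ i → ⟦ ℤ.- i ⟧ℤ ≈ - ⟦ i ⟧ℤ
  ⟦⟧-homo-‿ (+ zero)  = sym -0#≈0#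
  ⟦⟧-homo-‿ (+ suc n) = refl
  ⟦⟧-homo-‿ -[1+ n ]  = sym (-‿involutive _)

  -- Equality in `R` need not be decidable, whereas integers can be compared; with integer
  -- coefficients the solver can cancel terms and evaluate numerals.
  ℤ-homomorphism : ℤ.+-*-rawRing -Raw-AlmostCommutative⟶ fromCommutativeRing R
  ℤ-homomorphism = record
    { ⟦_⟧ = ⟦_⟧ℤ ; +-homo = ⟦⟧-homo-+ ; *-homo = ⟦⟧-homo-* ; -‿homo = ⟦⟧-homo-‿
    ; 0-homo = refl ; 1-homo = refl }

  ⟦⟧-≟ : ∀ i j → Maybe (⟦ i ⟧ℤ ≈ ⟦ j ⟧ℤ)
  ⟦⟧-≟ i j with i ℤ.≟ j
  ... | yes i≡j = just (reflexive (≡.cong ⟦_⟧ℤ i≡j))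
  ... | no  _   = nothing

  open import Algebra.Solver.Ring ℤ.+-*-rawRing (fromCommutativeRing R) ℤ-homomorphism ⟦⟧-≟ public
    using (solve; _:=_; _:+_; _:*_; _:-_; :-_; con)

-- Divisibility of binomial coefficients by a prime

nC0≡1 : ∀ n → n C 0 ≡ 1
nC0≡1 zero    = ≡.refl
nC0≡1 (suc n) = ≡.refl

C-absorption : ∀ n k → suc k ℕ.* (suc n C suc k) ≡ suc n ℕ.* (n C k)
C-absorption zero    zero    = ≡.refl
C-absorption zero    (suc k) = ℕ.*-zeroʳ (suc (suc k))
C-absorption (suc n) zero    = begin
  1 ℕ.* (suc (suc n) C 1)              ≡⟨ ≡.cong (1 ℕ.*_) (nCk+nC[k+1]≡[n+1]C[k+1] (suc n) 0) ⟨
  1 ℕ.* (1 ℕ.+ (suc n C 1))            ≡⟨ ℕ.*-distribˡ-+ 1 1 (suc n C 1) ⟩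
  1 ℕ.+ 1 ℕ.* (suc n C 1)              ≡⟨ ≡.cong suc (C-absorption n 0) ⟩
  1 ℕ.+ suc n ℕ.* (n C 0)              ≡⟨ ≡.cong (λ c → 1 ℕ.+ suc n ℕ.* c) (nC0≡1 n) ⟩
  suc (suc n) ℕ.* 1                    ∎
  where open ≡.≡-Reasoning
C-absorption (suc n) (suc k) = begin
  suc (suc k) ℕ.* (suc (suc n) C suc (suc k))
    ≡⟨ ≡.cong (suc (suc k) ℕ.*_) (nCk+nC[k+1]≡[n+1]C[k+1] (suc n) (suc k)) ⟨
  suc (suc k) ℕ.* (c ℕ.+ d)
    ≡⟨ expand k c d ⟩
  (suc k ℕ.* c ℕ.+ suc (suc k) ℕ.* d) ℕ.+ c
    ≡⟨ ≡.cong₂ (λ u v → (u ℕ.+ v) ℕ.+ c) (C-absorption n k) (C-absorption n (suc k)) ⟩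
  (suc n ℕ.* (n C k) ℕ.+ suc n ℕ.* (n C suc k)) ℕ.+ c
    ≡⟨ ≡.cong (ℕ._+ c) (ℕ.*-distribˡ-+ (suc n) (n C k) (n C suc k)) ⟨
  suc n ℕ.* ((n C k) ℕ.+ (n C suc k)) ℕ.+ c
    ≡⟨ ≡.cong (λ e → suc n ℕ.* e ℕ.+ c) (nCk+nC[k+1]≡[n+1]C[k+1] n k) ⟩
  suc n ℕ.* c ℕ.+ c
    ≡⟨ ℕ.+-comm (suc n ℕ.* c) c ⟩
  suc (suc n) ℕ.* c ∎
  where
  open ≡.≡-Reasoning
  c = suc n C suc k
  d = suc n C suc (suc k)
  expand : ∀ k c d → suc (suc k) ℕ.* (c ℕ.+ d) ≡ (suc k ℕ.* c ℕ.+ suc (suc k) ℕ.* d) ℕ.+ c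
  expand = ℕ-Ring.solve-∀

-- By absorption `suc n` divides `suc k` times the coefficient, and it cannot divide the smaller
-- number `suc k`.
p∣pCk : ∀ {n k} → Prime (suc n) → k ℕ.< n → suc n ∣ suc n C suc k
p∣pCk {n} {k} p-prime k<n
  with euclidsLemma (suc k) (suc n C suc k) p-prime
         (≡.subst (suc n ∣_) (≡.sym (C-absorption n k)) (m∣m*n (n C k)))
... | inj₁ p∣k = ⊥-elim (>⇒∤ (ℕ.s<s k<n) p∣k)
... | inj₂ p∣C = p∣C

-- The Frobenius map in characteristic p

module Frobenius {c ℓ} (R : CommutativeRing c ℓ) where
  open CommutativeRing R hiding (zero)
  open import Algebra.Properties.CommutativeSemiring.Exp commutativeSemiring
  open import Algebra.Properties.Semiring.Mult semiring renaming (_×_ to _·_)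
  open import Algebra.Properties.CommutativeMonoid.Sum +-commutativeMonoid
  import Algebra.Properties.CommutativeSemiring.Binomial commutativeSemiring as Binomial
  open import Relation.Binary.Reasoning.Setoid setoid

  AdditivePower : ℕ → Set _
  AdditivePower N = ∀ x y → (x + y) ^ N ≈ x ^ N + y ^ N

  ×-annihilates : ∀ {m n} → m · 1# ≈ 0# → m ∣ n → ∀ x → n · x ≈ 0#
  ×-annihilates {m} m×1≈0 (divides d ≡.refl) x = begin
    (d ℕ.* m) · x        ≈⟨ ×-assocˡ x d m ⟨
    d · (m · x)          ≈⟨ ×-congʳ d (×-congʳ m (*-identityˡ x)) ⟨
    d · (m · (1# * x))   ≈⟨ ×-congʳ d (×-assoc-* m 1# x) ⟨
    d · ((m · 1#) * x)   ≈⟨ ×-congʳ d (trans (*-congʳ m×1≈0) (zeroˡ x)) ⟩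
    d · 0#               ≈⟨ sum-replicate d ⟨
    sum {d} (λ _ → 0#)   ≈⟨ sum-replicate-zero d ⟩
    0#                   ∎

  -- In the binomial expansion only the two outer terms survive, all inner coefficients being
  -- multiples of p. The setting is a commutative ring because F[δ] needs the result as well as F.
  additive-prime : ∀ {p} → Prime p → p · 1# ≈ 0# → AdditivePower p
  additive-prime {zero}  p-prime p×1≈0 x y = ⊥-elim (ℕ.≢-nonZero⁻¹ 0 {{prime⇒nonZero p-prime}} ≡.refl)
  additive-prime {suc n} p-prime p×1≈0 x y = begin
    (x + y) ^ suc n                                     ≈⟨ Binomial.theorem (suc n) x y ⟩
    t zero + sum (t ∘ suc)                              ≈⟨ +-congˡ (sum-init-last (t ∘ suc)) ⟩
    t zero + (sum (t ∘ suc ∘ inject₁) + t (fromℕ (suc n))) ≈⟨ +-cong first (+-cong middle last-term) ⟩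
    y ^ suc n + (0# + x ^ suc n)                        ≈⟨ +-congˡ (+-identityˡ _) ⟩
    y ^ suc n + x ^ suc n                               ≈⟨ +-comm _ _ ⟩
    x ^ suc n + y ^ suc n                               ∎
    where
    t : Fin (suc (suc n)) → Carrier
    t = Binomial.binomialTerm x y (suc n)
    first : t zero ≈ y ^ suc n
    first = trans (×-homo-1 _) (*-identityˡ _)
    middle : sum (t ∘ suc ∘ inject₁) ≈ 0#
    middle = trans (sum-cong-≋ vanishes) (sum-replicate-zero n)
      where
      vanishes : ∀ i → t (suc (inject₁ i)) ≈ 0#
      vanishes i = ×-annihilates p×1≈0
        (p∣pCk p-prime (≡.subst (ℕ._< n) (≡.sym (toℕ-inject₁ i)) (toℕ<n i))) _
    last-term : t (fromℕ (suc n)) ≈ x ^ suc n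
    last-term = begin
      t (fromℕ (suc n))                  ≡⟨ ≡.cong (λ k → (suc n C k) · (x ^ k * y ^ (suc n ℕ.∸ k))) (toℕ-fromℕ (suc n)) ⟩
      (suc n C suc n) · (x ^ suc n * y ^ (n ℕ.∸ n)) ≡⟨ ≡.cong₂ (λ k l → k · (x ^ suc n * y ^ l)) (nCn≡1 (suc n)) (ℕ.n∸n≡0 n) ⟩
      1 · (x ^ suc n * 1#)               ≈⟨ trans (×-homo-1 _) (*-identityʳ _) ⟩
      x ^ suc n                          ∎

  additive-^ : ∀ {N} → AdditivePower N → ∀ k → AdditivePower (N ℕ.^ k)
  additive-^ additive zero    x y = distribʳ 1# x y
  additive-^ {N} additive (suc k) x y = begin
    (x + y) ^ (N ℕ.* N ℕ.^ k)             ≈⟨ ^-assocʳ (x + y) N (N ℕ.^ k) ⟨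
    ((x + y) ^ N) ^ (N ℕ.^ k)             ≈⟨ ^-congˡ (N ℕ.^ k) (additive x y) ⟩
    (x ^ N + y ^ N) ^ (N ℕ.^ k)           ≈⟨ additive-^ additive k _ _ ⟩
    (x ^ N) ^ (N ℕ.^ k) + (y ^ N) ^ (N ℕ.^ k) ≈⟨ +-cong (^-assocʳ x N (N ℕ.^ k)) (^-assocʳ y N (N ℕ.^ k)) ⟩
    x ^ (N ℕ.* N ℕ.^ k) + y ^ (N ℕ.* N ℕ.^ k) ∎

  additive-primePower : ∀ {p N} → Prime p → p · 1# ≈ 0# → ∀ k → N ≡ p ℕ.^ k → AdditivePower N
  additive-primePower p-prime p×1≈0 k ≡.refl = additive-^ (additive-prime p-prime p×1≈0) k

-- Cancellation, powers and the subfield F_q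

module FieldProperties {c ℓ} (K : Field c ℓ) where
  open Field K hiding (zero)
  open FieldDefs K
  open import Algebra.Properties.CommutativeSemiring.Exp commutativeSemiring
  open import Relation.Binary.Reasoning.Setoid setoid

  *-cancelˡ-nonZero : ∀ {x y z} → ¬ x ≈ 0# → x * y ≈ x * z → y ≈ z
  *-cancelˡ-nonZero {x} {y} {z} x≉0 xy≈xz with inverse x x≉0
  ... | x⁻¹ , xx⁻¹≈1 = begin
    y               ≈⟨ unit y ⟨
    x⁻¹ * (x * y)   ≈⟨ *-congˡ xy≈xz ⟩
    x⁻¹ * (x * z)   ≈⟨ unit z ⟩
    z               ∎
    where
    unit : ∀ w → x⁻¹ * (x * w) ≈ w
    unit w = begin
      x⁻¹ * (x * w) ≈⟨ *-assoc x⁻¹ x w ⟨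
      (x⁻¹ * x) * w ≈⟨ *-congʳ (trans (*-comm x⁻¹ x) xx⁻¹≈1) ⟩
      1# * w        ≈⟨ *-identityˡ w ⟩
      w             ∎

  *-nonZero : ∀ {x y} → ¬ x ≈ 0# → ¬ y ≈ 0# → ¬ x * y ≈ 0#
  *-nonZero x≉0 y≉0 xy≈0 = y≉0 (*-cancelˡ-nonZero x≉0 (trans xy≈0 (sym (zeroʳ _))))

  ^-nonZero : ∀ {x} → ¬ x ≈ 0# → ∀ n → ¬ x ^ n ≈ 0#
  ^-nonZero x≉0 zero    = 1≉0
  ^-nonZero x≉0 (suc n) = *-nonZero x≉0 (^-nonZero x≉0 n)

  pow≡^ : ∀ x n → pow x n ≡ x ^ n
  pow≡^ x zero    = ≡.refl
  pow≡^ x (suc n) = ≡.cong (x *_) (pow≡^ x n)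

  1^n≈1 : ∀ n → 1# ^ n ≈ 1#
  1^n≈1 zero    = refl
  1^n≈1 (suc n) = trans (*-identityˡ _) (1^n≈1 n)

  *-fixed : ∀ q {s t} → s ^ q ≈ s → t ^ q ≈ t → (s * t) ^ q ≈ s * t
  *-fixed q s∈Fq t∈Fq = trans (^-distrib-* _ _ q) (*-cong s∈Fq t∈Fq)

  inverse-fixed : ∀ q {s i} → s ^ q ≈ s → s * i ≈ 1# → i ^ q ≈ i
  inverse-fixed q {s} {i} s∈Fq si≈1 = *-cancelˡ-nonZero s≉0 (begin
    s * i ^ q       ≈⟨ *-congʳ s∈Fq ⟨
    s ^ q * i ^ q   ≈⟨ ^-distrib-* s i q ⟨
    (s * i) ^ q     ≈⟨ ^-congˡ q si≈1 ⟩
    1# ^ q          ≈⟨ 1^n≈1 q ⟩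
    1#              ≈⟨ si≈1 ⟨
    s * i           ∎)
    where
    s≉0 : ¬ s ≈ 0#
    s≉0 s≈0 = 1≉0 (trans (sym si≈1) (trans (*-congʳ s≈0) (zeroˡ i)))

-- Finite fields: characteristic, Fermat's theorem, (q+1)-st roots

module FiniteField {c ℓ} (K : Field c ℓ) (Q : ℕ) (card : FieldDefs.HasCardinality K Q) where
  open Field K hiding (zero)
  open FieldProperties K
  open import Algebra.Properties.CommutativeSemiring.Exp commutativeSemiring
  open import Algebra.Properties.Ring ring
  open import Algebra.Properties.Semiring.Mult semiring using (×1-homo-*; ×-homo-1) renaming (_×_ to _·_)
  import Algebra.Properties.CommutativeMonoid.Sum +-commutativeMonoid as Sum
  import Algebra.Properties.CommutativeMonoid.Sum *-commutativeMonoid as Product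
  open IntegerCoefficients commRing
  open import Relation.Binary.Reasoning.Setoid setoid

  elem : Fin Q → Carrier
  elem = proj₁ card

  elem-injective : ∀ i j → elem i ≈ elem j → i ≡ j
  elem-injective = proj₁ (proj₂ card)

  index : Carrier → Fin Q
  index x = proj₁ (proj₂ (proj₂ card) x)

  elem-index : ∀ x → elem (index x) ≈ x
  elem-index x = proj₂ (proj₂ (proj₂ card) x)

  infix 4 _≟_
  _≟_ : ∀ x y → Dec (x ≈ y)
  x ≟ y with index x ≟ᶠ index y
  ... | yes i≡j = yes (trans (sym (elem-index x)) (trans (reflexive (≡.cong elem i≡j)) (elem-index y)))
  ... | no  i≢j = no λ x≈y → i≢j (elem-injective _ _ (trans (elem-index x) (trans x≈y (sym (elem-index y)))))

  zeroProduct : ∀ {x y} → x * y ≈ 0# → x ≈ 0# ⊎ y ≈ 0#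
  zeroProduct {x} {y} xy≈0 with x ≟ 0# | y ≟ 0#
  ... | yes x≈0 | _       = inj₁ x≈0
  ... | no _    | yes y≈0 = inj₂ y≈0
  ... | no x≉0  | no y≉0  = ⊥-elim (*-nonZero x≉0 y≉0 xy≈0)

  permutationOf : (f g : Carrier → Carrier) → (∀ {x y} → x ≈ y → f x ≈ f y) → (∀ {x y} → x ≈ y → g x ≈ g y) →
    (∀ x → f (g x) ≈ x) → (∀ x → g (f x) ≈ x) → Perm.Permutation Q Q
  permutationOf f g f-cong g-cong fg gf = Perm.permutation
    (λ i → index (f (elem i))) (λ i → index (g (elem i)))
    (λ i → elem-injective _ _ (trans (elem-index _) (trans (f-cong (elem-index _)) (fg _))))
    (λ i → elem-injective _ _ (trans (elem-index _) (trans (g-cong (elem-index _)) (gf _))))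

  -- Translation by `1#` permutes F, so the sum of all elements equals itself plus `Q · 1#`.
  Q·1≈0 : Q · 1# ≈ 0#
  Q·1≈0 = +-identityʳ-unique total (Q · 1#) (sym (begin
    total                                          ≈⟨ Sum.sum-permute elem translation ⟩
    Sum.sum (λ i → elem (index (elem i + 1#)))     ≈⟨ Sum.sum-cong-≋ (λ i → elem-index (elem i + 1#)) ⟩
    Sum.sum (λ i → elem i + 1#)                    ≈⟨ Sum.∑-distrib-+ elem (λ _ → 1#) ⟩
    total + Sum.sum {Q} (λ _ → 1#)                 ≈⟨ +-congˡ (Sum.sum-replicate Q) ⟩
    total + Q · 1#                                 ∎))
    where
    total = Sum.sum elem
    translation = permutationOf (_+ 1#) (_- 1#) +-congʳ +-congʳ
      (solve 1 (λ x → (x :- con (+ 1)) :+ con (+ 1) := x) refl)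
      (solve 1 (λ x → (x :+ con (+ 1)) :- con (+ 1) := x) refl)

  product-delta : ∀ {n} (f : Fin n → Carrier) i → (∀ j → j ≢ i → f j ≈ 1#) → Product.sum f ≈ f i
  product-delta {suc n} f i f≈1 = begin
    Product.sum f                                          ≈⟨ Product.sum-remove {i = i} f ⟩
    f i * Product.sum {n} (λ j → f (punchIn i j))          ≈⟨ *-congˡ (Product.sum-cong-≋ (λ j → f≈1 _ (punchInᵢ≢i i j))) ⟩
    f i * Product.sum {n} (λ _ → 1#)                       ≈⟨ *-congˡ (Product.sum-replicate-zero n) ⟩
    f i * 1#                                               ≈⟨ *-identityʳ (f i) ⟩
    f i                                                    ∎

  product-nonZero : ∀ {n} (f : Fin n → Carrier) → (∀ i → ¬ f i ≈ 0#) → ¬ Product.sum f ≈ 0#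
  product-nonZero {zero}  f f≉0 = 1≉0
  product-nonZero {suc n} f f≉0 = *-nonZero (f≉0 zero) (product-nonZero (λ i → f (suc i)) (λ i → f≉0 (suc i)))

  ifZero_then_else_ : Carrier → Carrier → Carrier → Carrier
  ifZero x then y else z with x ≟ 0#
  ... | yes _ = y
  ... | no  _ = z

  ifZero-yes : ∀ {x y z} → x ≈ 0# → (ifZero x then y else z) ≈ y
  ifZero-yes {x} x≈0 with x ≟ 0#
  ... | yes _   = refl
  ... | no  x≉0 = ⊥-elim (x≉0 x≈0)

  ifZero-no : ∀ {x y z} → ¬ x ≈ 0# → (ifZero x then y else z) ≈ z
  ifZero-no {x} x≉0 with x ≟ 0#
  ... | yes x≈0 = ⊥-elim (x≉0 x≈0)
  ... | no  _   = refl

  -- Multiplication by a permutes F; in the product of all elements the factor 0 is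
  -- replaced by 1, and delta accounts for the discrepancy.
  x^Q≈x : ∀ a → a ^ Q ≈ a
  x^Q≈x a with a ≟ 0#
  ... | yes a≈0 = begin
    a ^ Q   ≈⟨ ^-congˡ Q a≈0 ⟩
    0# ^ Q  ≈⟨ 0^Q Q (index 0#) ⟩
    0#      ≈⟨ a≈0 ⟨
    a       ∎
    where
    0^Q : ∀ n → Fin n → 0# ^ n ≈ 0#
    0^Q (suc n) _ = zeroˡ _
  ... | no a≉0 = *-cancelˡ-nonZero total≉0 (begin
    total * a ^ Q                                        ≈⟨ *-congˡ (Product.sum-replicate Q) ⟨
    total * Product.sum {Q} (λ _ → a)                    ≈⟨ Product.∑-distrib-+ (λ i → unit (elem i)) (λ _ → a) ⟨
    Product.sum (λ i → unit (elem i) * a)                ≈⟨ Product.sum-cong-≋ (λ i → unit-scale (elem i)) ⟩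
    Product.sum (λ i → unit (a * elem i) * delta (elem i)) ≈⟨ Product.∑-distrib-+ (λ i → unit (a * elem i)) (λ i → delta (elem i)) ⟩
    Product.sum (λ i → unit (a * elem i)) * Product.sum (λ i → delta (elem i))
      ≈⟨ *-cong permuted (trans (product-delta (λ i → delta (elem i)) (index 0#) deltas) (ifZero-yes (elem-index 0#))) ⟩
    total * a                                            ∎)
    where
    unit delta : Carrier → Carrier
    unit x  = ifZero x then 1# else x
    delta x = ifZero x then a else 1#

    unit-cong : ∀ {x y} → x ≈ y → unit x ≈ unit y
    unit-cong {x} {y} x≈y with x ≟ 0# | y ≟ 0#
    ... | yes _   | yes _   = refl
    ... | yes x≈0 | no  y≉0 = ⊥-elim (y≉0 (trans (sym x≈y) x≈0))
    ... | no  x≉0 | yes y≈0 = ⊥-elim (x≉0 (trans x≈y y≈0))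
    ... | no  _   | no  _   = x≈y

    unit≉0 : ∀ x → ¬ unit x ≈ 0#
    unit≉0 x with x ≟ 0#
    ... | yes _   = 1≉0
    ... | no  x≉0 = x≉0

    unit-scale : ∀ x → unit x * a ≈ unit (a * x) * delta x
    unit-scale x with x ≟ 0#
    ... | yes x≈0 = *-congʳ (sym (ifZero-yes (trans (*-congˡ x≈0) (zeroʳ a))))
    ... | no  x≉0 = begin
      x * a                ≈⟨ *-comm x a ⟩
      a * x                ≈⟨ ifZero-no (*-nonZero a≉0 x≉0) ⟨
      unit (a * x)         ≈⟨ *-identityʳ _ ⟨
      unit (a * x) * 1#    ∎

    total = Product.sum (λ i → unit (elem i))
    total≉0 : ¬ total ≈ 0#
    total≉0 = product-nonZero (λ i → unit (elem i)) (λ i → unit≉0 (elem i))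

    a⁻¹ = proj₁ (inverse a a≉0)
    aa⁻¹≈1 = proj₂ (inverse a a≉0)

    scaling = permutationOf (a *_) (a⁻¹ *_) *-congˡ *-congˡ
      (λ x → trans (sym (*-assoc a a⁻¹ x)) (trans (*-congʳ aa⁻¹≈1) (*-identityˡ x)))
      (λ x → trans (sym (*-assoc a⁻¹ a x)) (trans (*-congʳ (trans (*-comm a⁻¹ a) aa⁻¹≈1)) (*-identityˡ x)))

    permuted : Product.sum (λ i → unit (a * elem i)) ≈ total
    permuted = begin
      Product.sum (λ i → unit (a * elem i))                 ≈⟨ Product.sum-cong-≋ (λ i → unit-cong (elem-index (a * elem i))) ⟨
      Product.sum (λ i → unit (elem (index (a * elem i))))  ≈⟨ Product.sum-permute (λ i → unit (elem i)) scaling ⟨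
      total                                                 ∎

    deltas : ∀ j → j ≢ index 0# → delta (elem j) ≈ 1#
    deltas j j≢i = ifZero-no λ ej≈0 → j≢i (elem-injective _ _ (trans ej≈0 (sym (elem-index 0#))))

  -- `Q · 1#` is the k-th power of `p · 1#`, and a field has no zero divisors; the exponent 0 would
  -- give 1 = 0.
  characteristic : ∀ {p} k → Q ≡ p ℕ.^ k → p · 1# ≈ 0#
  characteristic {p} k ≡.refl = root k Q·1≈0
    where
    root : ∀ k → (p ℕ.^ k) · 1# ≈ 0# → p · 1# ≈ 0#
    root zero    1≈0 = ⊥-elim (1≉0 (trans (sym (×-homo-1 1#)) 1≈0))
    root (suc k) p^k≈0 with zeroProduct (trans (sym (×1-homo-* p (p ℕ.^ k))) p^k≈0)
    ... | inj₁ p≈0   = p≈0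
    ... | inj₂ p^k≈0 = root k p^k≈0

  [q+1]-root : ∀ q M → 1 ℕ.+ Q ≡ (1 ℕ.+ q) ℕ.* M → ∀ z → z ^ M * (z ^ M) ^ q ≈ z * z
  [q+1]-root q M Q+1≡[q+1]M z = begin
    (z ^ M) ^ suc q       ≈⟨ ^-assocʳ z M (suc q) ⟩
    z ^ (M ℕ.* suc q)     ≡⟨ ≡.cong (z ^_) (≡.trans (ℕ.*-comm M (suc q)) (≡.sym Q+1≡[q+1]M)) ⟩
    z * z ^ Q             ≈⟨ *-congˡ (x^Q≈x z) ⟩
    z * z                 ∎

-- Polynomial functions and their roots over a commutative ring

module RootCounting {c ℓ} (R : CommutativeRing c ℓ) where
  open CommutativeRing R hiding (zero)
  open import Algebra.Properties.CommutativeSemiring.Exp commutativeSemiring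
  open IntegerCoefficients R
  open import Relation.Binary.Reasoning.Setoid setoid

  -- f is a polynomial function of formal degree d with leading coefficient a, in Horner form.
  Polynomial : Carrier → ℕ → (Carrier → Carrier) → Set (c ⊔ ℓ)
  Polynomial a zero    f = Level.Lift c (∀ x → f x ≈ a)
  Polynomial a (suc d) f = ∃₂ λ b g → Polynomial a d g × (∀ x → f x ≈ b + x * g x)

  monomial : ∀ d → Polynomial 1# d (_^ d)
  monomial zero    = Level.lift λ _ → refl
  monomial (suc d) = 0# , (_^ d) , monomial d , λ x → sym (+-identityˡ _)

  -- Synthetic division: for f = b + x g one has f x - f r = (x - r) g r + x (g x - g r), and the
  -- last difference is divided recursively. The leading coefficient passes unchanged to the
  -- quotient.
  factor : ∀ {a} d {f} → Polynomial a (suc d) f → ∀ r →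
    ∃ λ h → Polynomial a d h × (∀ x → f x - f r ≈ (x - r) * h x)
  factor {a} zero {f} (b , g , Level.lift g≈a , f≈) r = (λ _ → a) , Level.lift (λ _ → refl) , λ x → begin
    f x - f r                       ≈⟨ +-cong (f≈ x) (-‿cong (f≈ r)) ⟩
    (b + x * g x) - (b + r * g r)   ≈⟨ +-cong (+-congˡ (*-congˡ (g≈a x))) (-‿cong (+-congˡ (*-congˡ (g≈a r)))) ⟩
    (b + x * a) - (b + r * a)       ≈⟨ solve 4 (λ a b x r → (b :+ x :* a) :- (b :+ r :* a) := (x :- r) :* a) refl a b x r ⟩
    (x - r) * a                     ∎
  factor (suc d) {f} (b , g , g-poly , f≈) r with factor d g-poly r
  ... | h , h-poly , g≈ = (λ x → g r + x * h x) , (g r , h , h-poly , λ _ → refl) , λ x → begin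
    f x - f r                                    ≈⟨ +-cong (f≈ x) (-‿cong (f≈ r)) ⟩
    (b + x * g x) - (b + r * g r)                ≈⟨ solve 5 (λ b x r u v → (b :+ x :* u) :- (b :+ r :* v)
                                                      := (x :- r) :* v :+ x :* (u :- v)) refl b x r (g x) (g r) ⟩
    (x - r) * g r + x * (g x - g r)              ≈⟨ +-congˡ (*-congˡ (g≈ x)) ⟩
    (x - r) * g r + x * ((x - r) * h x)          ≈⟨ solve 4 (λ x r v w → (x :- r) :* v :+ x :* ((x :- r) :* w)
                                                      := (x :- r) :* (v :+ x :* w)) refl x r (g r) (h x) ⟩
    (x - r) * (g r + x * h x)                    ∎

  Regular : Carrier → Set (c ⊔ ℓ)
  Regular x = ∀ {y} → x * y ≈ 0# → y ≈ 0#

  -- Each root is divided out in turn, regularity of the differences keeping the other roots as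
  -- roots of the quotient. One root is left for the constant `a`.
  tooManyRoots : ∀ {a} d {f} → Polynomial a d f → (r : Fin (suc d) → Carrier) →
    (∀ i j → i ≢ j → Regular (r i - r j)) → (∀ i → f (r i) ≈ 0#) → a ≈ 0#
  tooManyRoots zero (Level.lift f≈a) r _ f≈0 = trans (sym (f≈a (r zero))) (f≈0 zero)
  tooManyRoots (suc d) {f} f-poly r regular f≈0 with factor d f-poly (r zero)
  ... | h , h-poly , f≈ = tooManyRoots d h-poly (r ∘ suc)
    (λ i j i≢j → regular (suc i) (suc j) (λ { ≡.refl → i≢j ≡.refl }))
    (λ i → regular (suc i) zero (λ ()) (begin
      (r (suc i) - r zero) * h (r (suc i)) ≈⟨ f≈ (r (suc i)) ⟨
      f (r (suc i)) - f (r zero)           ≈⟨ +-cong (f≈0 (suc i)) (-‿cong (f≈0 zero)) ⟩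
      0# - 0#                              ≈⟨ -‿inverseʳ 0# ⟩
      0#                                   ∎))

  -- The exponent is at least 2, so that subtracting `x` leaves the leading coefficient 1 alone.
  x^n-x-polynomial : ∀ n → Polynomial 1# (suc (suc n)) (λ x → x ^ suc (suc n) - x)
  x^n-x-polynomial n = 0# , (λ x → x ^ suc n - 1#) ,
    (- 1# , (_^ n) , monomial n , λ x → +-comm _ _) ,
    λ x → solve 2 (λ x y → x :* y :- x := con (+ 0) :+ x :* (y :- con (+ 1))) refl x (x ^ suc n)

-- The ring R[δ] with δ² = D; the pair (x , y) stands for x + y δ.
module QuadraticExtension {c ℓ} (R : CommutativeRing c ℓ) (D : CommutativeRing.Carrier R) where
  private module R = CommutativeRing R
  open R using (Carrier; _+_; _*_; -_; _-_; 0#; 1#; _≈_)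
  open IntegerCoefficients R

  infixl 7 _*ᴱ_
  _*ᴱ_ : Carrier × Carrier → Carrier × Carrier → Carrier × Carrier
  (x , y) *ᴱ (z , w) = x * z + D * (y * w) , x * w + y * z

  extension : CommutativeRing c ℓ
  extension = record
    { _*_ = _*ᴱ_
    ; 1#  = 1# , 0#
    ; isCommutativeRing = record
      { isRing = record
        { +-isAbelianGroup = isAbelianGroup
        ; *-cong = λ (x≈ , y≈) (z≈ , w≈) →
            R.+-cong (R.*-cong x≈ z≈) (R.*-congˡ (R.*-cong y≈ w≈)) ,
            R.+-cong (R.*-cong x≈ w≈) (R.*-cong y≈ z≈)
        ; *-assoc = λ (x , y) (z , w) (u , v) →
            solve 7 (λ d x y z w u v →
              (x :* z :+ d :* (y :* w)) :* u :+ d :* ((x :* w :+ y :* z) :* v)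
                := x :* (z :* u :+ d :* (w :* v)) :+ d :* (y :* (z :* v :+ w :* u)))
              R.refl D x y z w u v ,
            solve 7 (λ d x y z w u v →
              (x :* z :+ d :* (y :* w)) :* v :+ (x :* w :+ y :* z) :* u
                := x :* (z :* v :+ w :* u) :+ y :* (z :* u :+ d :* (w :* v)))
              R.refl D x y z w u v
        ; *-identity =
            (λ (x , y) →
              solve 3 (λ d x y → con (+ 1) :* x :+ d :* (con (+ 0) :* y) := x) R.refl D x y ,
              solve 2 (λ x y → con (+ 1) :* y :+ con (+ 0) :* x := y) R.refl x y) ,
            (λ (x , y) →
              solve 3 (λ d x y → x :* con (+ 1) :+ d :* (y :* con (+ 0)) := x) R.refl D x y ,
              solve 2 (λ x y → x :* con (+ 0) :+ y :* con (+ 1) := y) R.refl x y)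
        ; distrib =
            (λ (x , y) (z , w) (u , v) →
              solve 7 (λ d x y z w u v → x :* (z :+ u) :+ d :* (y :* (w :+ v))
                := (x :* z :+ d :* (y :* w)) :+ (x :* u :+ d :* (y :* v))) R.refl D x y z w u v ,
              solve 6 (λ x y z w u v → x :* (w :+ v) :+ y :* (z :+ u)
                := (x :* w :+ y :* z) :+ (x :* v :+ y :* u)) R.refl x y z w u v) ,
            (λ (x , y) (z , w) (u , v) →
              solve 7 (λ d x y z w u v → (z :+ u) :* x :+ d :* ((w :+ v) :* y)
                := (z :* x :+ d :* (w :* y)) :+ (u :* x :+ d :* (v :* y))) R.refl D x y z w u v ,
              solve 6 (λ x y z w u v → (z :+ u) :* y :+ (w :+ v) :* x
                := (z :* y :+ w :* x) :+ (u :* y :+ v :* x)) R.refl x y z w u v)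
        }
      ; *-comm = λ (x , y) (z , w) →
          solve 5 (λ d x y z w → x :* z :+ d :* (y :* w) := z :* x :+ d :* (w :* y)) R.refl D x y z w ,
          solve 4 (λ x y z w → x :* w :+ y :* z := z :* y :+ w :* x) R.refl x y z w
      }
    }
    where
    open AbelianGroup (DirectProduct.abelianGroup R.+-abelianGroup R.+-abelianGroup)

  private module E = CommutativeRing extension
  open import Algebra.Properties.CommutativeSemiring.Exp R.commutativeSemiring using (_^_)
  open import Algebra.Properties.Semiring.Mult R.semiring using () renaming (_×_ to _·_)
  open import Algebra.Properties.CommutativeSemiring.Exp E.commutativeSemiring as Eᴱ using () renaming (_^_ to _^ᴱ_) public
  open import Algebra.Properties.Semiring.Mult E.semiring using () renaming (_×_ to _·ᴱ_) public
  open import Relation.Binary.Reasoning.Setoid E.setoid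

  ι : Carrier → E.Carrier
  ι x = x , 0#

  δ : E.Carrier
  δ = 0# , 1#

  conj : E.Carrier → E.Carrier
  conj (x , y) = x , - y

  norm : E.Carrier → Carrier
  norm (x , y) = x * x - D * (y * y)

  ι-* : ∀ x y → ι (x * y) E.≈ ι x E.* ι y
  ι-* x y = solve 3 (λ d x y → x :* y := x :* y :+ d :* (con (+ 0) :* con (+ 0))) R.refl D x y ,
    solve 2 (λ x y → con (+ 0) := x :* con (+ 0) :+ con (+ 0) :* y) R.refl x y

  ι-^ : ∀ x n → ι (x ^ n) E.≈ ι x ^ᴱ n
  ι-^ x zero    = E.refl
  ι-^ x (suc n) = E.trans (ι-* x (x ^ n)) (E.*-congˡ (ι-^ x n))

  conj-norm : ∀ z → conj z E.* z E.≈ ι (norm z)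
  conj-norm (x , y) = solve 3 (λ d x y → x :* x :+ d :* ((:- y) :* y) := x :* x :- d :* (y :* y)) R.refl D x y ,
    solve 2 (λ x y → x :* y :+ (:- y) :* x := con (+ 0)) R.refl x y

  n·1 : ∀ n → n ·ᴱ E.1# E.≈ ι (n · 1#)
  n·1 zero    = E.refl
  n·1 (suc n) = E.trans (E.+-congˡ (n·1 n)) (R.refl , R.+-identityˡ 0#)

  decompose : ∀ x y → (x , y) E.≈ ι x E.+ ι y E.* δ
  decompose x y = solve 3 (λ d x y → x := x :+ (y :* con (+ 0) :+ d :* (con (+ 0) :* con (+ 1)))) R.refl D x y ,
    solve 1 (λ y → y := con (+ 0) :+ (y :* con (+ 1) :+ con (+ 0) :* con (+ 0))) R.refl y

  δ^odd : ∀ h → δ ^ᴱ (1 ℕ.+ 2 ℕ.* h) E.≈ ι (D ^ h) E.* δ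
  δ^odd h = begin
    δ E.* δ ^ᴱ (2 ℕ.* h)       ≈⟨ E.*-comm _ _ ⟩
    δ ^ᴱ (2 ℕ.* h) E.* δ       ≈⟨ E.*-congʳ (Eᴱ.^-assocʳ δ 2 h) ⟨
    (δ ^ᴱ 2) ^ᴱ h E.* δ        ≈⟨ E.*-congʳ (Eᴱ.^-congˡ h δ²≈D) ⟩
    ι D ^ᴱ h E.* δ             ≈⟨ E.*-congʳ (ι-^ D h) ⟨
    ι (D ^ h) E.* δ            ∎
    where
    δ²≈D : δ ^ᴱ 2 E.≈ ι D
    δ²≈D = solve 1 (λ d → con (+ 0) :* (con (+ 0) :* con (+ 1) :+ d :* (con (+ 1) :* con (+ 0)))
               :+ d :* (con (+ 1) :* (con (+ 0) :* con (+ 0) :+ con (+ 1) :* con (+ 1))) := d) R.refl D ,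
           solve 1 (λ d → con (+ 0) :* (con (+ 0) :* con (+ 0) :+ con (+ 1) :* con (+ 1))
               :+ con (+ 1) :* (con (+ 0) :* con (+ 1) :+ d :* (con (+ 1) :* con (+ 0))) := con (+ 0)) R.refl D

  -- Additivity separates the powers of x and of y δ, and δ^(2h+1) = D^h δ. It serves for both
  -- Frobenius maps, with exponent q and with exponent Q.
  odd-power : ∀ h → Frobenius.AdditivePower extension (1 ℕ.+ 2 ℕ.* h) → ∀ x y →
    (x , y) ^ᴱ (1 ℕ.+ 2 ℕ.* h) E.≈ (x ^ (1 ℕ.+ 2 ℕ.* h) , y ^ (1 ℕ.+ 2 ℕ.* h) * D ^ h)
  odd-power h additive x y = begin
    (x , y) ^ᴱ N                              ≈⟨ Eᴱ.^-congˡ N (decompose x y) ⟩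
    (ι x E.+ ι y E.* δ) ^ᴱ N                  ≈⟨ additive (ι x) (ι y E.* δ) ⟩
    ι x ^ᴱ N E.+ (ι y E.* δ) ^ᴱ N             ≈⟨ E.+-congˡ (Eᴱ.^-distrib-* (ι y) δ N) ⟩
    ι x ^ᴱ N E.+ ι y ^ᴱ N E.* δ ^ᴱ N          ≈⟨ E.+-cong (E.sym (ι-^ x N)) (E.*-cong (E.sym (ι-^ y N)) (δ^odd h)) ⟩
    ι (x ^ N) E.+ ι (y ^ N) E.* (ι (D ^ h) E.* δ) ≈⟨ E.+-congˡ (E.*-assoc _ _ _) ⟨
    ι (x ^ N) E.+ ι (y ^ N) E.* ι (D ^ h) E.* δ   ≈⟨ E.+-congˡ (E.*-congʳ (ι-* _ _)) ⟨
    ι (x ^ N) E.+ ι (y ^ N * D ^ h) E.* δ     ≈⟨ decompose _ _ ⟨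
    (x ^ N , y ^ N * D ^ h)                   ∎
    where N = 1 ℕ.+ 2 ℕ.* h

module Representation {c ℓ} (K : Field c ℓ) (q : ℕ) (α : Field.Carrier K) where
  open Field K
  open import Algebra.Properties.CommutativeSemiring.Exp commutativeSemiring

  -- `x` and `y` may vanish here: the equations are solved for every non-zero pair, and the position
  -- of the point is considered only afterwards.
  record Represents (a b : Carrier) : Set (c ⊔ ℓ) where
    field
      x y s t : Carrier
      s∈Fq    : s ^ q ≈ s
      t∈Fq    : t ^ q ≈ t
      a≈      : a ≈ s * (x * x) + t * (y * y)
      b≈      : b ≈ s * (x * x ^ q) + t * (α * (y * y ^ q))

-- Adjoining the root of a non-square: norm, Euler's criterion, conjugation

module NonSquare {c ℓ} (K : Field c ℓ) (h : ℕ)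
  (card : FieldDefs.HasCardinality K (1 ℕ.+ 2 ℕ.* suc h))
  (D : Field.Carrier K) (nonSquare : ∀ d → ¬ Field._≈_ K (Field._*_ K d d) D) where
  open Field K hiding (zero)
  open FieldProperties K
  open FiniteField K _ card
  open QuadraticExtension commRing D
  private module E = CommutativeRing extension
  open import Algebra.Properties.CommutativeSemiring.Exp commutativeSemiring
  open import Algebra.Properties.Ring ring
  import Algebra.Properties.Ring E.ring as Eᵖ
  open IntegerCoefficients commRing
  open RootCounting extension

  D≉0 : ¬ D ≈ 0#
  D≉0 D≈0 = nonSquare 0# (trans (zeroˡ 0#) (sym D≈0))

  -- If x² = D y² with y non-zero, then D is the square of x / y; if y = 0, then x² = 0.
  norm≉0 : ∀ {x y} → ¬ (x ≈ 0# × y ≈ 0#) → ¬ norm (x , y) ≈ 0#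
  norm≉0 {x} {y} xy≉0 norm≈0 with y ≟ 0#
  ... | yes y≈0 = xy≉0 (x≈0 , y≈0)
    where
    open SetoidReasoning setoid
    x²≈0 : x * x ≈ 0#
    x²≈0 = begin
      x * x                   ≈⟨ solve 2 (λ d x → x :* x := x :* x :- d :* (con (+ 0) :* con (+ 0))) refl D x ⟩
      x * x - D * (0# * 0#)   ≈⟨ +-congˡ (-‿cong (*-congˡ (*-cong y≈0 y≈0))) ⟨
      norm (x , y)            ≈⟨ norm≈0 ⟩
      0#                      ∎
    x≈0 : x ≈ 0#
    x≈0 with zeroProduct x²≈0
    ... | inj₁ eq = eq
    ... | inj₂ eq = eq
  ... | no y≉0 with inverse y y≉0
  ... | i , yi≈1 = nonSquare (x * i) (begin
    (x * i) * (x * i)                                   ≈⟨ solve 4 (λ d x y i → (x :* i) :* (x :* i)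
                                                             := (x :* x :- d :* (y :* y)) :* (i :* i) :+ d :* ((y :* i) :* (y :* i))) refl D x y i ⟩
    norm (x , y) * (i * i) + D * ((y * i) * (y * i))    ≈⟨ +-cong (*-congʳ norm≈0) (*-congˡ (*-cong yi≈1 yi≈1)) ⟩
    0# * (i * i) + D * (1# * 1#)                        ≈⟨ solve 2 (λ d i → con (+ 0) :* (i :* i) :+ d :* (con (+ 1) :* con (+ 1)) := d) refl D i ⟩
    D                                                   ∎)
    where open SetoidReasoning setoid

  -- Multiplying by the conjugate turns the factor `(x , y)` into the scalar `norm (x , y)`, which
  -- is cancelled in each coordinate.
  regular : ∀ {x y} → ¬ (x ≈ 0# × y ≈ 0#) → Regular (x , y)
  regular {x} {y} xy≉0 {z , w} prod≈0 =
      cancel (trans (solve 4 (λ d n z w → n :* z := n :* z :+ d :* (con (+ 0) :* w)) refl D N z w) (proj₁ scaled))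
    , cancel (trans (solve 3 (λ n z w → n :* w := n :* w :+ con (+ 0) :* z) refl N z w) (proj₂ scaled))
    where
    open SetoidReasoning E.setoid
    N = norm (x , y)
    cancel : ∀ {v} → N * v ≈ 0# → v ≈ 0#
    cancel Nv≈0 = *-cancelˡ-nonZero (norm≉0 xy≉0) (trans Nv≈0 (sym (zeroʳ N)))
    scaled : ι N E.* (z , w) E.≈ E.0#
    scaled = begin
      ι N E.* (z , w)                          ≈⟨ E.*-congʳ (conj-norm (x , y)) ⟨
      conj (x , y) E.* (x , y) E.* (z , w)     ≈⟨ E.*-assoc _ _ _ ⟩
      conj (x , y) E.* ((x , y) E.* (z , w))   ≈⟨ E.*-congˡ prod≈0 ⟩
      conj (x , y) E.* E.0#                    ≈⟨ E.zeroʳ _ ⟩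
      E.0#                                     ∎

  *ᴱ-cancelˡ : ∀ {x y z w} → ¬ (x ≈ 0# × y ≈ 0#) → (x , y) E.* z E.≈ (x , y) E.* w → z E.≈ w
  *ᴱ-cancelˡ {x} {y} {z} {w} xy≉0 eq = Eᵖ.x∙y⁻¹≈ε⇒x≈y _ _ (regular xy≉0 (begin
    (x , y) E.* (z E.- w)                  ≈⟨ Eᵖ.x[y-z]≈xy-xz _ _ _ ⟩
    (x , y) E.* z E.- (x , y) E.* w        ≈⟨ E.+-congʳ eq ⟩
    (x , y) E.* w E.- (x , y) E.* w        ≈⟨ E.-‿inverseʳ _ ⟩
    E.0#                                   ∎))
    where open SetoidReasoning E.setoid

  -- If D^h were 1, then δ and the elements of F would be too many roots of X^Q - X in F[δ].
  D^h≉1 : ¬ D ^ suc h ≈ 1#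
  -- The argument `h + suc (h + 0)` is `Q - 2` in the shape to which `Q` reduces, so the polynomial
  -- has degree `Q` and `suc Q` roots are supplied.
  D^h≉1 D^h≈1 = 1≉0 (proj₁ (tooManyRoots _ (x^n-x-polynomial (h ℕ.+ suc (h ℕ.+ 0))) roots separated vanishes))
    where
    open SetoidReasoning E.setoid
    Q = 1 ℕ.+ 2 ℕ.* suc h
    roots : Fin (suc Q) → E.Carrier
    roots zero    = δ
    roots (suc i) = ι (elem i)
    separated : ∀ i j → i ≢ j → Regular (roots i E.- roots j)
    separated zero    zero    i≢j = ⊥-elim (i≢j ≡.refl)
    separated zero    (suc j) _   = regular λ (_ , eq) → 1≉0 (x∙y⁻¹≈ε⇒x≈y _ _ eq)
    separated (suc i) zero    _   = regular λ (_ , eq) → 1≉0 (sym (x∙y⁻¹≈ε⇒x≈y _ _ eq))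
    separated (suc i) (suc j) i≢j = regular λ (eq , _) → i≢j (≡.cong suc (elem-injective i j (x∙y⁻¹≈ε⇒x≈y _ _ eq)))
    fixed : ∀ i → roots i ^ᴱ Q E.≈ roots i
    fixed zero    = begin
      δ ^ᴱ Q                     ≈⟨ δ^odd (suc h) ⟩
      ι (D ^ suc h) E.* δ        ≈⟨ E.*-congʳ (D^h≈1 , refl) ⟩
      E.1# E.* δ                 ≈⟨ E.*-identityˡ δ ⟩
      δ                          ∎
    fixed (suc i) = E.trans (E.sym (ι-^ (elem i) Q)) (x^Q≈x (elem i) , refl)
    vanishes : ∀ i → roots i ^ᴱ Q E.- roots i E.≈ E.0#
    vanishes i = E.trans (E.+-congʳ (fixed i)) (E.-‿inverseʳ (roots i))

  -- Here `suc h` is (Q - 1) / 2, so this power of D has square D^(Q-1) = 1 and is 1 or -1; the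
  -- value 1 has been excluded.
  euler : D ^ suc h ≈ - 1#
  euler with zeroProduct product≈0
    where
    open SetoidReasoning setoid
    H = D ^ suc h
    square : H * H ≈ 1#
    square = *-cancelˡ-nonZero D≉0 (begin
      D * (H * H)                    ≈⟨ *-congˡ (^-homo-* D (suc h) (suc h)) ⟨
      D * D ^ (suc h ℕ.+ suc h)      ≡⟨ ≡.cong (λ k → D * D ^ (suc h ℕ.+ k)) (≡.sym (ℕ.+-identityʳ (suc h))) ⟩
      D ^ (1 ℕ.+ 2 ℕ.* suc h)        ≈⟨ x^Q≈x D ⟩
      D                              ≈⟨ *-identityʳ D ⟨
      D * 1#                         ∎)
    product≈0 : (H - 1#) * (H + 1#) ≈ 0#
    product≈0 = begin
      (H - 1#) * (H + 1#)   ≈⟨ solve 1 (λ x → (x :- con (+ 1)) :* (x :+ con (+ 1)) := x :* x :- con (+ 1)) refl H ⟩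
      H * H - 1#            ≈⟨ +-congʳ square ⟩
      1# - 1#               ≈⟨ -‿inverseʳ 1# ⟩
      0#                    ∎
  ... | inj₁ H-1≈0 = ⊥-elim (D^h≉1 (x∙y⁻¹≈ε⇒x≈y _ _ H-1≈0))
  ... | inj₂ H+1≈0 = +-inverseˡ-unique _ _ H+1≈0

  -- The Q-th power fixes both coordinates and sends δ to D^((Q-1)/2) δ = -δ.
  frobenius-conj : Frobenius.AdditivePower extension (1 ℕ.+ 2 ℕ.* suc h) →
    ∀ z → z ^ᴱ (1 ℕ.+ 2 ℕ.* suc h) E.≈ conj z
  frobenius-conj additive (x , y) = E.trans (odd-power (suc h) additive x y)
    (x^Q≈x x , trans (*-cong (x^Q≈x y) euler) (trans (*-comm y (- 1#)) (-1*x≈-x y)))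

-- Odd q: square and non-square discriminants

-- q = 2 r + 3 is odd, Q = 2 h + 3 and L = (Q - 1) / (q - 1) = 2 l + 1.
module OddOrder {c ℓ} (K : Field c ℓ) (r l M : ℕ)
  (card : FieldDefs.HasCardinality K (1 ℕ.+ 2 ℕ.* suc (2 ℕ.* l ℕ.+ r ℕ.* (1 ℕ.+ 2 ℕ.* l))))
  (p i j : ℕ) (p-prime : Prime p)
  (q≡p^i : 1 ℕ.+ 2 ℕ.* suc r ≡ p ℕ.^ i)
  (Q≡p^j : 1 ℕ.+ 2 ℕ.* suc (2 ℕ.* l ℕ.+ r ℕ.* (1 ℕ.+ 2 ℕ.* l)) ≡ p ℕ.^ j)
  (Q+1≡[q+1]M : 2 ℕ.+ 2 ℕ.* suc (2 ℕ.* l ℕ.+ r ℕ.* (1 ℕ.+ 2 ℕ.* l)) ≡ (2 ℕ.+ 2 ℕ.* suc r) ℕ.* M)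
  where
  q L R h Q : ℕ
  q = 1 ℕ.+ 2 ℕ.* suc r
  L = 1 ℕ.+ 2 ℕ.* l
  R = 1 ℕ.+ l ℕ.+ r ℕ.* L
  h = 2 ℕ.* l ℕ.+ r ℕ.* L
  Q = 1 ℕ.+ 2 ℕ.* suc h

  open Field K hiding (zero)
  open FieldProperties K
  open FiniteField K Q card
  open Representation K q (- 1#)
  open import Algebra.Properties.CommutativeSemiring.Exp commutativeSemiring
  open import Algebra.Properties.Ring ring
  open import Algebra.Properties.Semiring.Mult semiring using (×1-homo-*; ×-homo-1) renaming (_×_ to _·_)
  open IntegerCoefficients commRing

  p·1≈0 : p · 1# ≈ 0#
  p·1≈0 = characteristic j Q≡p^j

  additive : Frobenius.AdditivePower commRing q
  additive = Frobenius.additive-primePower commRing p-prime p·1≈0 i q≡p^i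

  module _ where
    open SetoidReasoning setoid

    q*L≡2l+Q : L ℕ.* q ≡ 2 ℕ.* l ℕ.+ Q
    q*L≡2l+Q = identity r l
      where
      identity : ∀ r l → (1 ℕ.+ 2 ℕ.* l) ℕ.* (1 ℕ.+ 2 ℕ.* (1 ℕ.+ r))
        ≡ 2 ℕ.* l ℕ.+ (1 ℕ.+ 2 ℕ.* (1 ℕ.+ (2 ℕ.* l ℕ.+ r ℕ.* (1 ℕ.+ 2 ℕ.* l))))
      identity = ℕ-Ring.solve-∀

    Q≡L+R*2 : Q ≡ L ℕ.+ R ℕ.* 2
    Q≡L+R*2 = identity r l
      where
      identity : ∀ r l → 1 ℕ.+ 2 ℕ.* (1 ℕ.+ (2 ℕ.* l ℕ.+ r ℕ.* (1 ℕ.+ 2 ℕ.* l)))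
        ≡ (1 ℕ.+ 2 ℕ.* l) ℕ.+ (1 ℕ.+ l ℕ.+ r ℕ.* (1 ℕ.+ 2 ℕ.* l)) ℕ.* 2
      identity = ℕ-Ring.solve-∀

    -- x ↦ x^L is the norm from F to F_q.
    x^L∈Fq : ∀ x → (x ^ L) ^ q ≈ x ^ L
    x^L∈Fq x = begin
      (x ^ L) ^ q             ≈⟨ ^-assocʳ x L q ⟩
      x ^ (L ℕ.* q)           ≡⟨ ≡.cong (x ^_) q*L≡2l+Q ⟩
      x ^ (2 ℕ.* l ℕ.+ Q)     ≈⟨ ^-homo-* x (2 ℕ.* l) Q ⟩
      x ^ (2 ℕ.* l) * x ^ Q   ≈⟨ *-congˡ (x^Q≈x x) ⟩
      x ^ (2 ℕ.* l) * x       ≈⟨ *-comm _ x ⟩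
      x ^ L                   ∎

    -- Since `L` is odd, Q = L + 2 R; splitting x = x^Q accordingly exhibits the factor in F_q as
    -- the norm `x ^ L`.
    squareClass : ∀ x → x ≈ x ^ L * (x ^ R * x ^ R)
    squareClass x = begin
      x                         ≈⟨ x^Q≈x x ⟨
      x ^ Q                     ≡⟨ ≡.cong (x ^_) Q≡L+R*2 ⟩
      x ^ (L ℕ.+ R ℕ.* 2)       ≈⟨ ^-homo-* x L (R ℕ.* 2) ⟩
      x ^ L * x ^ (R ℕ.* 2)     ≈⟨ *-congˡ (^-assocʳ x R 2) ⟨
      x ^ L * (x ^ R) ^ 2       ≈⟨ *-congˡ (*-congˡ (*-identityʳ _)) ⟩
      x ^ L * (x ^ R * x ^ R)   ∎

    neg-^q : ∀ x → (- x) ^ q ≈ - (x ^ q)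
    neg-^q x = +-inverseˡ-unique _ _ (begin
      (- x) ^ q + x ^ q   ≈⟨ additive (- x) x ⟨
      (- x + x) ^ q       ≈⟨ ^-congˡ q (-‿inverseˡ x) ⟩
      0# ^ q              ≈⟨ zeroˡ _ ⟩
      0#                  ∎)

    neg-∈Fq : ∀ {t} → t ^ q ≈ t → (- t) ^ q ≈ - t
    neg-∈Fq t∈Fq = trans (neg-^q _) (-‿cong t∈Fq)

    2≉0 : ¬ 1# + 1# ≈ 0#
    2≉0 2≈0 = 1≉0 (begin
      1#                                  ≈⟨ +-identityʳ 1# ⟨
      1# + 0#                             ≈⟨ +-congˡ (zeroˡ (suc h · 1#)) ⟨
      1# + 0# * (suc h · 1#)              ≈⟨ +-congˡ (*-congʳ 2≈0) ⟨
      1# + (1# + 1#) * (suc h · 1#)       ≈⟨ +-congˡ (*-congʳ (+-congˡ (×-homo-1 1#))) ⟨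
      1# + (2 · 1#) * (suc h · 1#)        ≈⟨ +-congˡ (×1-homo-* 2 (suc h)) ⟨
      Q · 1#                              ≈⟨ Q·1≈0 ⟩
      0#                                  ∎)

    ½ : Carrier
    ½ = proj₁ (inverse (1# + 1#) 2≉0)

    2*½≈1 : (1# + 1#) * ½ ≈ 1#
    2*½≈1 = proj₂ (inverse (1# + 1#) 2≉0)

    ½∈Fq : ½ ^ q ≈ ½
    ½∈Fq = inverse-fixed q (trans (additive 1# 1#) (+-cong (1^n≈1 q) (1^n≈1 q))) 2*½≈1

    -- In the coordinates u = x + y, v = x - y the conditions s (x² - y²) = a, s (x^(q+1) + y^(q+1)) = b
    -- read s u v = a, s (u^(q+1) + v^(q+1)) = 2 b, so that s u^(q+1) and s v^(q+1) are the
    -- roots b ± d of W² - 2 b W + a^(q+1).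
    squareDiscriminant-root : ∀ {a b} d → d * d ≈ b * b - a * a ^ q → ¬ b + d ≈ 0# → Represents a b
    squareDiscriminant-root {a} {b} d d²≈ W≉0 = record
      { x = (u + v) * ½ ; y = (u - v) * ½ ; s = s ; t = - s
      ; s∈Fq = x^L∈Fq W ; t∈Fq = neg-∈Fq (x^L∈Fq W) ; a≈ = sym a-equation ; b≈ = sym b-equation }
      where
      W = b + d
      s = W ^ L
      -- `squareClass` gives W = s (W^R)², and the `M`-th power of `W ^ R` is a (q+1)-st root of
      -- that square.
      u = (W ^ R) ^ M
      W≈ : s * (u * u ^ q) ≈ W
      W≈ = trans (*-congˡ ([q+1]-root q M Q+1≡[q+1]M (W ^ R))) (sym (squareClass W))
      su≉0 : ¬ s * u ≈ 0#
      su≉0 = *-nonZero (^-nonZero W≉0 L) (^-nonZero (^-nonZero W≉0 R) M)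
      su⁻¹ = proj₁ (inverse (s * u) su≉0)
      v = a * su⁻¹
      suv≈a : s * u * v ≈ a
      suv≈a = begin
        s * u * (a * su⁻¹)    ≈⟨ solve 4 (λ s u a i → s :* u :* (a :* i) := a :* (s :* u :* i)) refl s u a su⁻¹ ⟩
        a * (s * u * su⁻¹)    ≈⟨ *-congˡ (proj₂ (inverse (s * u) su≉0)) ⟩
        a * 1#             ≈⟨ *-identityʳ a ⟩
        a                  ∎
      W′≈ : s * (v * v ^ q) ≈ b - d
      -- As s^q = s, the product of s u^(q+1) and s v^(q+1) is (s u v)^(q+1) = a^(q+1) = (b + d)(b -
      -- d), from which the first factor `W` is cancelled.
      W′≈ = *-cancelˡ-nonZero W≉0 (begin
        W * (s * (v * v ^ q))                        ≈⟨ *-congʳ W≈ ⟨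
        s * (u * u ^ q) * (s * (v * v ^ q))          ≈⟨ solve 5 (λ s u u′ v v′ → s :* (u :* u′) :* (s :* (v :* v′)) := s :* u :* v :* (s :* u′ :* v′)) refl s u (u ^ q) v (v ^ q) ⟩
        s * u * v * (s * u ^ q * v ^ q)              ≈⟨ *-congˡ (*-congʳ (*-congʳ (x^L∈Fq W))) ⟨
        s * u * v * (s ^ q * u ^ q * v ^ q)          ≈⟨ *-congˡ (*-congʳ (^-distrib-* s u q)) ⟨
        s * u * v * ((s * u) ^ q * v ^ q)            ≈⟨ *-congˡ (^-distrib-* (s * u) v q) ⟨
        s * u * v * (s * u * v) ^ q                  ≈⟨ *-cong suv≈a (^-congˡ q suv≈a) ⟩
        a * a ^ q                                    ≈⟨ solve 2 (λ b n → n := b :* b :- (b :* b :- n)) refl b (a * a ^ q) ⟩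
        b * b - (b * b - a * a ^ q)                  ≈⟨ +-congˡ (-‿cong d²≈) ⟨
        b * b - d * d                                ≈⟨ solve 2 (λ b d → b :* b :- d :* d := (b :+ d) :* (b :- d)) refl b d ⟩
        W * (b - d)                                  ∎)
      a-equation : s * ((u + v) * ½ * ((u + v) * ½)) + - s * ((u - v) * ½ * ((u - v) * ½)) ≈ a
      a-equation = begin
        s * ((u + v) * ½ * ((u + v) * ½)) + - s * ((u - v) * ½ * ((u - v) * ½))
          ≈⟨ solve 4 (λ s u v ½ → s :* ((u :+ v) :* ½ :* ((u :+ v) :* ½)) :+ (:- s) :* ((u :- v) :* ½ :* ((u :- v) :* ½))
               := s :* u :* v :* (((con (+ 1) :+ con (+ 1)) :* ½) :* ((con (+ 1) :+ con (+ 1)) :* ½))) refl s u v ½ ⟩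
        s * u * v * (((1# + 1#) * ½) * ((1# + 1#) * ½))
          ≈⟨ *-cong suv≈a (*-cong 2*½≈1 2*½≈1) ⟩
        a * (1# * 1#)  ≈⟨ solve 1 (λ a → a :* (con (+ 1) :* con (+ 1)) := a) refl a ⟩
        a              ∎
      x^q : ((u + v) * ½) ^ q ≈ (u ^ q + v ^ q) * ½
      x^q = trans (^-distrib-* (u + v) ½ q) (*-cong (additive u v) ½∈Fq)
      y^q : ((u - v) * ½) ^ q ≈ (u ^ q - v ^ q) * ½
      y^q = trans (^-distrib-* (u - v) ½ q) (*-cong (trans (additive u (- v)) (+-congˡ (neg-^q v))) ½∈Fq)
      b-equation : s * ((u + v) * ½ * ((u + v) * ½) ^ q) + - s * (- 1# * ((u - v) * ½ * ((u - v) * ½) ^ q)) ≈ b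
      b-equation = begin
        s * ((u + v) * ½ * ((u + v) * ½) ^ q) + - s * (- 1# * ((u - v) * ½ * ((u - v) * ½) ^ q))
          ≈⟨ +-cong (*-congˡ (*-congˡ x^q)) (*-congˡ (*-congˡ (*-congˡ y^q))) ⟩
        s * ((u + v) * ½ * ((u ^ q + v ^ q) * ½)) + - s * (- 1# * ((u - v) * ½ * ((u ^ q - v ^ q) * ½)))
          ≈⟨ solve 6 (λ s u v u′ v′ ½ → s :* ((u :+ v) :* ½ :* ((u′ :+ v′) :* ½)) :+ (:- s) :* (:- con (+ 1) :* ((u :- v) :* ½ :* ((u′ :- v′) :* ½)))
               := (s :* (u :* u′) :+ s :* (v :* v′)) :* ½ :* ((con (+ 1) :+ con (+ 1)) :* ½)) refl s u v (u ^ q) (v ^ q) ½ ⟩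
        (s * (u * u ^ q) + s * (v * v ^ q)) * ½ * ((1# + 1#) * ½)
          ≈⟨ *-congʳ (*-congʳ (+-cong W≈ W′≈)) ⟩
        (b + d + (b - d)) * ½ * ((1# + 1#) * ½)
          ≈⟨ solve 3 (λ b d ½ → (b :+ d :+ (b :- d)) :* ½ :* ((con (+ 1) :+ con (+ 1)) :* ½)
               := b :* (((con (+ 1) :+ con (+ 1)) :* ½) :* ((con (+ 1) :+ con (+ 1)) :* ½))) refl b d ½ ⟩
        b * (((1# + 1#) * ½) * ((1# + 1#) * ½))
          ≈⟨ *-congˡ (*-cong 2*½≈1 2*½≈1) ⟩
        b * (1# * 1#)  ≈⟨ solve 1 (λ b → b :* (con (+ 1) :* con (+ 1)) := b) refl b ⟩
        b              ∎

    -- Either root of the quadratic will do provided it is non-zero; if both vanish, so do their sum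
    -- 2 b and their product a^(q+1).
    squareDiscriminant : ∀ {a b} d → ¬ (a ≈ 0# × b ≈ 0#) → d * d ≈ b * b - a * a ^ q → Represents a b
    squareDiscriminant {a} {b} d ab≉0 d²≈ with (b + d) ≟ 0# | (b - d) ≟ 0#
    ... | no b+d≉0  | _         = squareDiscriminant-root d d²≈ b+d≉0
    ... | yes _     | no b-d≉0  = squareDiscriminant-root (- d)
      (trans (solve 1 (λ d → (:- d) :* (:- d) := d :* d) refl d) d²≈) b-d≉0
    ... | yes b+d≈0 | yes b-d≈0 = ⊥-elim (ab≉0 (a≈0 , b≈0))
      where
      b≈0 : b ≈ 0#
      b≈0 = *-cancelˡ-nonZero 2≉0 (begin
        (1# + 1#) * b           ≈⟨ solve 2 (λ b d → (con (+ 1) :+ con (+ 1)) :* b := (b :+ d) :+ (b :- d)) refl b d ⟩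
        (b + d) + (b - d)       ≈⟨ +-cong b+d≈0 b-d≈0 ⟩
        0# + 0#                 ≈⟨ +-identityˡ 0# ⟩
        0#                      ≈⟨ zeroʳ _ ⟨
        (1# + 1#) * 0#          ∎)
      a^[q+1]≈0 : a ^ suc q ≈ 0#
      a^[q+1]≈0 = begin
        a * a ^ q                                ≈⟨ solve 2 (λ b n → n := b :* b :- (b :* b :- n)) refl b (a * a ^ q) ⟩
        b * b - (b * b - a * a ^ q)              ≈⟨ +-congˡ (-‿cong d²≈) ⟨
        b * b - d * d                            ≈⟨ solve 2 (λ b d → b :* b :- d :* d := (b :+ d) :* (b :- d)) refl b d ⟩
        (b + d) * (b - d)                        ≈⟨ *-congʳ b+d≈0 ⟩
        0# * (b - d)                             ≈⟨ zeroˡ _ ⟩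
        0#                                       ∎
      a≈0 : a ≈ 0#
      a≈0 with a ≟ 0#
      ... | yes eq  = eq
      ... | no  a≉0 = ⊥-elim (^-nonZero a≉0 (suc q) a^[q+1]≈0)

  module NonSquareDiscriminant (a b : Carrier)
    (nonSquare : ∀ d → ¬ d * d ≈ b * b - a * a ^ q) where
    D = b * b - a * a ^ q
    open QuadraticExtension commRing D
    open NonSquare K h card D nonSquare
    private module E = CommutativeRing extension
    private module Eˢ = IntegerCoefficients extension
    import Algebra.Properties.CommutativeSemiring.Exp E.commutativeSemiring as Eᴱ

    p·1ᴱ≈0 : p ·ᴱ E.1# E.≈ E.0#
    p·1ᴱ≈0 = E.trans (n·1 p) (p·1≈0 , refl)

    conj≈^Q : ∀ z → z ^ᴱ Q E.≈ conj z
    conj≈^Q = frobenius-conj (Frobenius.additive-primePower extension p-prime p·1ᴱ≈0 j Q≡p^j)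

    -- W = b + δ is a root of W² - 2 b W + a^(q+1) in F[δ]. Since c₀² = a^(q+1), the element W / c₀ has
    -- norm 1, so it is g / ḡ for g = c₀ + W; as conjugation is the Q-th power, u = e ḡ^L satisfies
    -- u^(q-1) = W / a. Up to the factor k in F_q, s u ū and s u^q ū are therefore a and W; comparing
    -- coordinates yields the two equations to be solved.
    s = a ^ L
    e = a ^ R
    c₀ = s * (e * e ^ q)

    c₀²≈ : c₀ * c₀ ≈ a * a ^ q
    c₀²≈ = begin
      s * (e * e ^ q) * (s * (e * e ^ q))      ≈⟨ solve 3 (λ s e f → s :* (e :* f) :* (s :* (e :* f)) := s :* (e :* e) :* (s :* (f :* f))) refl s e (e ^ q) ⟩
      s * (e * e) * (s * (e ^ q * e ^ q))      ≈⟨ *-cong (squareClass a) (*-cong (x^L∈Fq a) (^-distrib-* e e q)) ⟨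
      a * (s ^ q * (e * e) ^ q)                ≈⟨ *-congˡ (^-distrib-* s (e * e) q) ⟨
      a * (s * (e * e)) ^ q                    ≈⟨ *-congˡ (^-congˡ q (squareClass a)) ⟨
      a * a ^ q                                ∎
      where open SetoidReasoning setoid

    W g u : E.Carrier
    W = b , 1#
    g = c₀ + b , 1#
    -- Since L (q - 1) = Q - 1, the (q-1)-st power of ḡ^L is g / ḡ = W / c₀. The factor `e` corrects
    -- this to W / a, because a = s e² and c₀ = s e^(q+1). Here a is non-zero, as otherwise D = b².
    u = ι e E.* conj g ^ᴱ L

    -- The norm of W is b² - D = a^(q+1) = c₀², hence W (c₀ + W̄) = c₀ W + c₀² = c₀ (W + c₀).
    Wḡ≈c₀g : W E.* conj g E.≈ ι c₀ E.* g
    Wḡ≈c₀g = (begin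
        b * (c₀ + b) + D * (1# * - 1#)
          ≈⟨ solve 3 (λ b c n → b :* (c :+ b) :+ (b :* b :- n) :* (con (+ 1) :* :- con (+ 1)) := b :* c :+ n) refl b c₀ (a * a ^ q) ⟩
        b * c₀ + a * a ^ q
          ≈⟨ +-congˡ c₀²≈ ⟨
        b * c₀ + c₀ * c₀
          ≈⟨ solve 3 (λ b c d → b :* c :+ c :* c := c :* (c :+ b) :+ d :* (con (+ 0) :* con (+ 1))) refl b c₀ D ⟩
        c₀ * (c₀ + b) + D * (0# * 1#) ∎)
      , solve 2 (λ b c → b :* (:- con (+ 1)) :+ con (+ 1) :* (c :+ b) := c :* con (+ 1) :+ con (+ 0) :* (c :+ b)) refl b c₀
      where open SetoidReasoning setoid

    -- The norm of `g` taken from F[δ] to F and on to F_q, so that division by it keeps the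
    -- coefficients of the solution in F_q.
    k = norm g ^ L

    module _ where
      open SetoidReasoning E.setoid

      ḡ^L*g^L : conj g ^ᴱ L E.* g ^ᴱ L E.≈ ι k
      ḡ^L*g^L = begin
        conj g ^ᴱ L E.* g ^ᴱ L      ≈⟨ Eᴱ.^-distrib-* (conj g) g L ⟨
        (conj g E.* g) ^ᴱ L         ≈⟨ Eᴱ.^-congˡ L (conj-norm g) ⟩
        ι (norm g) ^ᴱ L             ≈⟨ ι-^ (norm g) L ⟨
        ι k                         ∎

      -- Conjugation is the Q-th power, so it passes through the product and the exponent `L`.
      conj-u : conj u E.≈ ι e E.* g ^ᴱ L
      conj-u = E.trans (E.sym (conj≈^Q u)) (begin
        (ι e E.* conj g ^ᴱ L) ^ᴱ Q                 ≈⟨ Eᴱ.^-distrib-* (ι e) (conj g ^ᴱ L) Q ⟩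
        ι e ^ᴱ Q E.* (conj g ^ᴱ L) ^ᴱ Q            ≈⟨ E.*-cong (E.trans (E.sym (ι-^ e Q)) (x^Q≈x e , refl)) (^-swap (conj g) L Q) ⟩
        ι e E.* (conj g ^ᴱ Q) ^ᴱ L                 ≈⟨ E.*-congˡ (Eᴱ.^-congˡ L (E.trans (conj≈^Q (conj g)) (refl , -‿involutive 1#))) ⟩
        ι e E.* g ^ᴱ L                             ∎)
        where
        ^-swap : ∀ z m n → (z ^ᴱ m) ^ᴱ n E.≈ (z ^ᴱ n) ^ᴱ m
        ^-swap z m n = E.trans (Eᴱ.^-assocʳ z m n)
          (E.trans (Eᴱ.^-congʳ z (ℕ.*-comm m n)) (E.sym (Eᴱ.^-assocʳ z n m)))

      norm-u : norm u ≈ e * e * k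
      norm-u = proj₁ (begin
        ι (norm u)                                                   ≈⟨ conj-norm u ⟨
        conj u E.* u                                                 ≈⟨ E.*-congʳ conj-u ⟩
        (ι e E.* g ^ᴱ L) E.* (ι e E.* conj g ^ᴱ L)                   ≈⟨ Eˢ.solve 3 (λ e x y → (e Eˢ.:* x) Eˢ.:* (e Eˢ.:* y) Eˢ.:= e Eˢ.:* e Eˢ.:* (y Eˢ.:* x))
                                                                          E.refl (ι e) (g ^ᴱ L) (conj g ^ᴱ L) ⟩
        ι e E.* ι e E.* (conj g ^ᴱ L E.* g ^ᴱ L)                     ≈⟨ E.*-cong (E.sym (ι-* e e)) ḡ^L*g^L ⟩
        ι (e * e) E.* ι k                                            ≈⟨ ι-* (e * e) k ⟨
        ι (e * e * k)                                                ∎)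

      u^q : u ^ᴱ q E.≈ ι (e ^ q) E.* (conj g ^ᴱ (2 ℕ.* l) E.* g)
      u^q = begin
        (ι e E.* conj g ^ᴱ L) ^ᴱ q                             ≈⟨ Eᴱ.^-distrib-* (ι e) (conj g ^ᴱ L) q ⟩
        ι e ^ᴱ q E.* (conj g ^ᴱ L) ^ᴱ q                        ≈⟨ E.*-cong (E.sym (ι-^ e q)) (Eᴱ.^-assocʳ (conj g) L q) ⟩
        ι (e ^ q) E.* conj g ^ᴱ (L ℕ.* q)                      ≈⟨ E.*-congˡ (Eᴱ.^-congʳ (conj g) q*L≡2l+Q) ⟩
        ι (e ^ q) E.* conj g ^ᴱ (2 ℕ.* l ℕ.+ Q)                ≈⟨ E.*-congˡ (Eᴱ.^-homo-* (conj g) (2 ℕ.* l) Q) ⟩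
        ι (e ^ q) E.* (conj g ^ᴱ (2 ℕ.* l) E.* conj g ^ᴱ Q)    ≈⟨ E.*-congˡ (E.*-congˡ (E.trans (conj≈^Q (conj g)) (refl , -‿involutive 1#))) ⟩
        ι (e ^ q) E.* (conj g ^ᴱ (2 ℕ.* l) E.* g)              ∎

      s*u^q*ū≈k*W : ι s E.* (u ^ᴱ q E.* conj u) E.≈ ι k E.* W
      -- u^q contains only the factor ḡ^(L-1). The additional ḡ completes it to ḡ^L, which combines
      -- with the g^L from ū to give `k`; the remaining c₀ g is W ḡ, and ḡ cancels.
      s*u^q*ū≈k*W = *ᴱ-cancelˡ (λ (_ , -1≈0) → 1≉0 (trans (sym (-‿involutive 1#)) (trans (-‿cong -1≈0) -0#≈0#))) (begin
        conj g E.* (ι s E.* (u ^ᴱ q E.* conj u))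
          ≈⟨ E.*-congˡ (E.*-congˡ (E.*-cong u^q conj-u)) ⟩
        conj g E.* (ι s E.* (ι (e ^ q) E.* (conj g ^ᴱ (2 ℕ.* l) E.* g) E.* (ι e E.* g ^ᴱ L)))
          ≈⟨ Eˢ.solve 7 (λ g̅ s e′ x g e y → g̅ Eˢ.:* (s Eˢ.:* (e′ Eˢ.:* (x Eˢ.:* g) Eˢ.:* (e Eˢ.:* y)))
               Eˢ.:= (s Eˢ.:* (e Eˢ.:* e′)) Eˢ.:* ((g̅ Eˢ.:* x) Eˢ.:* y) Eˢ.:* g) E.refl
               (conj g) (ι s) (ι (e ^ q)) (conj g ^ᴱ (2 ℕ.* l)) g (ι e) (g ^ᴱ L) ⟩
        (ι s E.* (ι e E.* ι (e ^ q))) E.* (conj g ^ᴱ L E.* g ^ᴱ L) E.* g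
          ≈⟨ E.*-congʳ (E.*-cong (E.trans (E.*-congˡ (E.sym (ι-* e (e ^ q)))) (E.sym (ι-* s (e * e ^ q)))) ḡ^L*g^L) ⟩
        ι c₀ E.* ι k E.* g
          ≈⟨ Eˢ.solve 3 (λ c k g → c Eˢ.:* k Eˢ.:* g Eˢ.:= k Eˢ.:* (c Eˢ.:* g)) E.refl (ι c₀) (ι k) g ⟩
        ι k E.* (ι c₀ E.* g)
          ≈⟨ E.*-congˡ Wḡ≈c₀g ⟨
        ι k E.* (W E.* conj g)
          ≈⟨ Eˢ.solve 3 (λ k w g → k Eˢ.:* (w Eˢ.:* g) Eˢ.:= g Eˢ.:* (k Eˢ.:* w)) E.refl (ι k) W (conj g) ⟩
        conj g E.* (ι k E.* W) ∎)

    open SetoidReasoning setoid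

    X Y : Carrier
    X = proj₁ u
    Y = proj₂ u

    -- First coordinate of s u^q ū = k W, with u^q expanded by `odd-power`; `suc r` is (q - 1) / 2.
    b-coordinate : s * (X ^ q * X - D ^ suc r * D * (Y ^ q * Y)) ≈ k * b
    b-coordinate = begin
      s * (X ^ q * X - D ^ suc r * D * (Y ^ q * Y))
        ≈⟨ solve 8 (λ s x′ x d d′ y′ y w → s :* (x′ :* x :- d′ :* d :* (y′ :* y))
             := s :* (x′ :* x :+ d :* (y′ :* d′ :* :- y)) :+ d :* (con (+ 0) :* w))
             refl s (X ^ q) X D (D ^ suc r) (Y ^ q) Y (proj₂ (ū-times (X ^ q , Y ^ q * D ^ suc r))) ⟩
      proj₁ (ι s E.* ū-times (X ^ q , Y ^ q * D ^ suc r))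
        ≈⟨ proj₁ (E.*-congˡ {ι s} (E.*-congʳ {conj u} (odd-power (suc r) (Frobenius.additive-primePower extension p-prime p·1ᴱ≈0 i q≡p^i) X Y))) ⟨
      proj₁ (ι s E.* ū-times (u ^ᴱ q))
        ≈⟨ proj₁ s*u^q*ū≈k*W ⟩
      k * b + D * (0# * 1#)
        ≈⟨ solve 3 (λ k b d → k :* b :+ d :* (con (+ 0) :* con (+ 1)) := k :* b) refl k b D ⟩
      k * b ∎
      where
      ū-times : E.Carrier → E.Carrier
      ū-times z = z E.* conj u

    k≉0 : ¬ k ≈ 0#
    k≉0 = ^-nonZero (norm≉0 (λ (_ , 1≈0) → 1≉0 1≈0)) L

    k⁻¹ = proj₁ (inverse k k≉0)
    kk⁻¹≈1 = proj₂ (inverse k k≉0)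
    ν = D ^ L
    ε = D ^ R

    -- D = ν ε² is raised to the power (q + 1) / 2. The sign comes from ν^((q-1)/2) = D^((Q-1)/2) =
    -- -1 and is the one that fits α = -1.
    D^[r+1] : D ^ suc r * D ≈ - (ν * (ε * ε ^ q))
    D^[r+1] = begin
      D ^ suc r * D                                       ≈⟨ *-comm _ _ ⟩
      D ^ suc (suc r)                                     ≈⟨ ^-congˡ (suc (suc r)) (squareClass D) ⟩
      (ν * (ε * ε)) ^ suc (suc r)                         ≈⟨ ^-distrib-* ν (ε * ε) (suc (suc r)) ⟩
      ν * ν ^ suc r * (ε * ε) ^ suc (suc r)               ≈⟨ *-cong (*-congˡ ν^r≈-1) ε-power ⟩
      ν * - 1# * (ε * ε ^ q)                              ≈⟨ solve 2 (λ v e → v :* :- con (+ 1) :* e := :- (v :* e)) refl ν (ε * ε ^ q) ⟩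
      - (ν * (ε * ε ^ q))                                 ∎
      where
      ν^r≈-1 : ν ^ suc r ≈ - 1#
      ν^r≈-1 = begin
        (D ^ L) ^ suc r       ≈⟨ ^-assocʳ D L (suc r) ⟩
        D ^ (L ℕ.* suc r)     ≡⟨ ≡.cong (D ^_) (ℕ.*-comm L (suc r)) ⟩
        D ^ suc h             ≈⟨ euler ⟩
        - 1#                  ∎
      ε-power : (ε * ε) ^ suc (suc r) ≈ ε * ε ^ q
      ε-power = begin
        (ε * ε) ^ suc (suc r)          ≈⟨ ^-congˡ (suc (suc r)) (*-congˡ (*-identityʳ ε)) ⟨
        (ε ^ 2) ^ suc (suc r)          ≈⟨ ^-assocʳ ε 2 (suc (suc r)) ⟩
        ε ^ (2 ℕ.* suc (suc r))        ≡⟨ ≡.cong (ε ^_) (ℕ.*-distribˡ-+ 2 1 (suc r)) ⟩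
        ε * ε ^ q                      ∎

    represents : Represents a b
    represents = record
      -- As D = ν ε², the norm of u is X² - ν (ε Y)²: moving ε into `y` leaves a coefficient in F_q.
      -- Dividing by `k` removes the factor common to both equations.
      { x = X ; y = ε * Y ; s = s * k⁻¹ ; t = - (s * k⁻¹ * ν)
      ; s∈Fq = s′∈Fq ; t∈Fq = neg-∈Fq (*-fixed q s′∈Fq (x^L∈Fq D)) ; a≈ = sym a-equation ; b≈ = sym b-equation }
      where
      s′∈Fq : (s * k⁻¹) ^ q ≈ s * k⁻¹
      s′∈Fq = *-fixed q (x^L∈Fq a) (inverse-fixed q (x^L∈Fq (norm g)) kk⁻¹≈1)
      a-equation : s * k⁻¹ * (X * X) + - (s * k⁻¹ * ν) * (ε * Y * (ε * Y)) ≈ a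
      a-equation = begin
        s * k⁻¹ * (X * X) + - (s * k⁻¹ * ν) * (ε * Y * (ε * Y))
          ≈⟨ solve 6 (λ s i x v e y → s :* i :* (x :* x) :+ (:- (s :* i :* v)) :* (e :* y :* (e :* y))
               := s :* i :* (x :* x :- v :* (e :* e) :* (y :* y))) refl s k⁻¹ X ν ε Y ⟩
        s * k⁻¹ * (X * X - ν * (ε * ε) * (Y * Y))
          ≈⟨ *-congˡ (+-congˡ (-‿cong (*-congʳ (squareClass D)))) ⟨
        s * k⁻¹ * norm u
          ≈⟨ *-congˡ norm-u ⟩
        s * k⁻¹ * (e * e * k)
          ≈⟨ solve 4 (λ s i e k → s :* i :* (e :* e :* k) := s :* (e :* e) :* (k :* i)) refl s k⁻¹ e k ⟩
        s * (e * e) * (k * k⁻¹)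
          ≈⟨ *-cong (sym (squareClass a)) kk⁻¹≈1 ⟩
        a * 1#  ≈⟨ *-identityʳ a ⟩
        a       ∎
      b-equation : s * k⁻¹ * (X * X ^ q) + - (s * k⁻¹ * ν) * (- 1# * (ε * Y * (ε * Y) ^ q)) ≈ b
      b-equation = begin
        s * k⁻¹ * (X * X ^ q) + - (s * k⁻¹ * ν) * (- 1# * (ε * Y * (ε * Y) ^ q))
          ≈⟨ +-congˡ (*-congˡ (*-congˡ (*-congˡ (^-distrib-* ε Y q)))) ⟩
        s * k⁻¹ * (X * X ^ q) + - (s * k⁻¹ * ν) * (- 1# * (ε * Y * (ε ^ q * Y ^ q)))
          ≈⟨ solve 9 (λ s i x x′ v e e′ y y′ → s :* i :* (x :* x′) :+ (:- (s :* i :* v)) :* (:- con (+ 1) :* (e :* y :* (e′ :* y′)))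
               := i :* (s :* (x′ :* x :- (:- (v :* (e :* e′))) :* (y′ :* y)))) refl s k⁻¹ X (X ^ q) ν ε (ε ^ q) Y (Y ^ q) ⟩
        k⁻¹ * (s * (X ^ q * X - - (ν * (ε * ε ^ q)) * (Y ^ q * Y)))
          ≈⟨ *-congˡ (*-congˡ (+-congˡ (-‿cong (*-congʳ D^[r+1])))) ⟨
        k⁻¹ * (s * (X ^ q * X - D ^ suc r * D * (Y ^ q * Y)))
          ≈⟨ *-congˡ b-coordinate ⟩
        k⁻¹ * (k * b)
          ≈⟨ solve 3 (λ i k b → i :* (k :* b) := k :* i :* b) refl k⁻¹ k b ⟩
        k * k⁻¹ * b  ≈⟨ *-congʳ kk⁻¹≈1 ⟩
        1# * b       ≈⟨ *-identityˡ b ⟩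
        b            ∎

  represents : ∀ a b → ¬ (a ≈ 0# × b ≈ 0#) → Represents a b
  represents a b ab≉0 with any? (λ i → (elem i * elem i) ≟ (b * b - a * a ^ q))
  ... | yes (i , d²≈) = squareDiscriminant (elem i) ab≉0 d²≈
  ... | no  nonSquare = NonSquareDiscriminant.represents a b λ d d²≈ →
    nonSquare (index d , trans (*-cong (elem-index d) (elem-index d)) d²≈)

-- Even q

module EvenOrder {c ℓ} (K : Field c ℓ) (q H M : ℕ)
  (card : FieldDefs.HasCardinality K (2 ℕ.* H))
  (i j : ℕ) (q≡2^i : q ≡ 2 ℕ.^ i) (Q≡2^j : 2 ℕ.* H ≡ 2 ℕ.^ j)
  (Q+1≡[q+1]M : 1 ℕ.+ 2 ℕ.* H ≡ (1 ℕ.+ q) ℕ.* M)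
  (α : Field.Carrier K) (α∈Fq : FieldDefs.InFq K q α) (α≉1 : ¬ Field._≈_ K α (Field.1# K))
  where
  open Field K hiding (zero)
  open FieldProperties K
  open FiniteField K (2 ℕ.* H) card
  open Representation K q α
  open import Algebra.Properties.CommutativeSemiring.Exp commutativeSemiring
  open import Algebra.Properties.Ring ring
  open import Algebra.Properties.Semiring.Mult semiring using () renaming (_×_ to _·_)
  open IntegerCoefficients commRing
  open import Relation.Binary.Reasoning.Setoid setoid

  2·1≈0 : 2 · 1# ≈ 0#
  2·1≈0 = characteristic j Q≡2^j

  1+1≈0 : 1# + 1# ≈ 0#
  1+1≈0 = trans (+-congˡ (sym (+-identityʳ 1#))) 2·1≈0

  additive : Frobenius.AdditivePower commRing q
  additive = Frobenius.additive-primePower commRing prime[2] 2·1≈0 i q≡2^i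

  √-square : ∀ x → x ^ H * x ^ H ≈ x
  √-square x = begin
    x ^ H * x ^ H          ≈⟨ ^-homo-* x H H ⟨
    x ^ (H ℕ.+ H)           ≡⟨ ≡.cong (λ k → x ^ (H ℕ.+ k)) (≡.sym (ℕ.+-identityʳ H)) ⟩
    x ^ (2 ℕ.* H)           ≈⟨ x^Q≈x x ⟩
    x                        ∎

  1+α≉0 : ¬ 1# + α ≈ 0#
  1+α≉0 1+α≈0 = α≉1 (+-cancelˡ 1# _ _ (trans 1+α≈0 (sym 1+1≈0)))

  -- With y = x + c₀ and c₀² = a only the second equation is left. The shift x = z + β c₀,
  -- β = α / (1 + α), removes its terms linear in z, so that it prescribes z^(q+1).
  represents : ∀ a b → Represents a b
  represents a b = record
    { x = x ; y = y ; s = 1# ; t = 1# ; s∈Fq = 1^n≈1 q ; t∈Fq = 1^n≈1 q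
    ; a≈ = sym a-equation ; b≈ = sym b-equation }
    where
    [1+α]⁻¹ = proj₁ (inverse (1# + α) 1+α≉0)
    [1+α]*[1+α]⁻¹≈1 = proj₂ (inverse (1# + α) 1+α≉0)
    β = α * [1+α]⁻¹
    c₀ = a ^ H
    -- As x = z + β c₀ and y = z + (β + 1) c₀, `γ` is the coefficient of c₀^(q+1) that the shift
    -- leaves behind, and `w` is the value then forced on z^(q+1).
    γ = β * β + α * ((β + 1#) * (β + 1#))
    w = [1+α]⁻¹ * (b - γ * (c₀ * c₀ ^ q))
    z = (w ^ H) ^ M
    x = z + β * c₀
    y = x + c₀
    [1+α]β≈α : (1# + α) * β ≈ α
    [1+α]β≈α = begin
      (1# + α) * (α * [1+α]⁻¹)     ≈⟨ solve 2 (λ a i → (con (+ 1) :+ a) :* (a :* i) := a :* ((con (+ 1) :+ a) :* i)) refl α [1+α]⁻¹ ⟩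
      α * ((1# + α) * [1+α]⁻¹)     ≈⟨ *-congˡ [1+α]*[1+α]⁻¹≈1 ⟩
      α * 1#                       ≈⟨ *-identityʳ α ⟩
      α                            ∎
    cross≈0 : β + α * (β + 1#) ≈ 0#
    cross≈0 = begin
      β + α * (β + 1#)             ≈⟨ solve 2 (λ a b → b :+ a :* (b :+ con (+ 1)) := (con (+ 1) :+ a) :* b :+ a) refl α β ⟩
      (1# + α) * β + α             ≈⟨ +-congʳ [1+α]β≈α ⟩
      α + α                        ≈⟨ solve 1 (λ a → a :+ a := (con (+ 1) :+ con (+ 1)) :* a) refl α ⟩
      (1# + 1#) * α                ≈⟨ *-congʳ 1+1≈0 ⟩
      0# * α                       ≈⟨ zeroˡ α ⟩
      0#                           ∎
    x^q : x ^ q ≈ z ^ q + β * c₀ ^ q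
    x^q = begin
      (z + β * c₀) ^ q            ≈⟨ additive z (β * c₀) ⟩
      z ^ q + (β * c₀) ^ q       ≈⟨ +-congˡ (^-distrib-* β c₀ q) ⟩
      z ^ q + β ^ q * c₀ ^ q    ≈⟨ +-congˡ (*-congʳ β∈Fq) ⟩
      z ^ q + β * c₀ ^ q         ∎
      where
      α^q≈α : α ^ q ≈ α
      α^q≈α = trans (reflexive (≡.sym (pow≡^ α q))) α∈Fq
      β∈Fq : β ^ q ≈ β
      β∈Fq = *-fixed q α^q≈α (inverse-fixed q (trans (additive 1# α) (+-cong (1^n≈1 q) α^q≈α)) [1+α]*[1+α]⁻¹≈1)
    a-equation : 1# * (x * x) + 1# * (y * y) ≈ a
    a-equation = begin
      1# * (x * x) + 1# * (y * y)               ≈⟨ solve 2 (λ x c → con (+ 1) :* (x :* x) :+ con (+ 1) :* ((x :+ c) :* (x :+ c))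
                                                     := (con (+ 1) :+ con (+ 1)) :* (x :* (x :+ c)) :+ c :* c) refl x c₀ ⟩
      (1# + 1#) * (x * (x + c₀)) + c₀ * c₀      ≈⟨ +-cong (trans (*-congʳ 1+1≈0) (zeroˡ _)) (√-square a) ⟩
      0# + a                                    ≈⟨ +-identityˡ a ⟩
      a                                         ∎
    b-equation : 1# * (x * x ^ q) + 1# * (α * (y * y ^ q)) ≈ b
    b-equation = begin
      1# * (x * x ^ q) + 1# * (α * (y * y ^ q))
        ≈⟨ +-cong (*-congˡ (*-congˡ x^q)) (*-congˡ (*-congˡ (*-congˡ (trans (additive x c₀) (+-congʳ x^q))))) ⟩
      1# * (x * (z ^ q + β * c₀ ^ q)) + 1# * (α * (y * (z ^ q + β * c₀ ^ q + c₀ ^ q)))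
        ≈⟨ solve 6 (λ a b z z′ c c′ →
             con (+ 1) :* ((z :+ b :* c) :* (z′ :+ b :* c′)) :+ con (+ 1) :* (a :* ((z :+ b :* c :+ c) :* (z′ :+ b :* c′ :+ c′)))
             := (con (+ 1) :+ a) :* (z :* z′) :+ (b :+ a :* (b :+ con (+ 1))) :* (z :* c′ :+ c :* z′)
                :+ (b :* b :+ a :* ((b :+ con (+ 1)) :* (b :+ con (+ 1)))) :* (c :* c′))
             refl α β z (z ^ q) c₀ (c₀ ^ q) ⟩
      (1# + α) * (z * z ^ q) + (β + α * (β + 1#)) * (z * c₀ ^ q + c₀ * z ^ q) + γ * (c₀ * c₀ ^ q)
        ≈⟨ +-congʳ (+-cong (*-congˡ (trans ([q+1]-root q M Q+1≡[q+1]M (w ^ H)) (√-square w))) (trans (*-congʳ cross≈0) (zeroˡ _))) ⟩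
      (1# + α) * ([1+α]⁻¹ * (b - γ * (c₀ * c₀ ^ q))) + 0# + γ * (c₀ * c₀ ^ q)
        ≈⟨ solve 4 (λ a i b d → a :* (i :* (b :- d)) :+ con (+ 0) :+ d := (a :* i) :* (b :- d) :+ d) refl (1# + α) [1+α]⁻¹ b (γ * (c₀ * c₀ ^ q)) ⟩
      ((1# + α) * [1+α]⁻¹) * (b - γ * (c₀ * c₀ ^ q)) + γ * (c₀ * c₀ ^ q)
        ≈⟨ +-congʳ (*-congʳ [1+α]*[1+α]⁻¹≈1) ⟩
      1# * (b - γ * (c₀ * c₀ ^ q)) + γ * (c₀ * c₀ ^ q)
        ≈⟨ solve 2 (λ b d → con (+ 1) :* (b :- d) :+ d := b) refl b (γ * (c₀ * c₀ ^ q)) ⟩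
      b ∎

-- From solutions of the equations to secant lines

module Secants {c ℓ} (K : Field c ℓ) (q Q : ℕ) (card : FieldDefs.HasCardinality K Q) (α : Field.Carrier K) where
  open Field K
  open FieldDefs K
  open FieldProperties K
  open FiniteField K Q card
  open Representation K q α
  open import Algebra.Properties.CommutativeSemiring.Exp commutativeSemiring
  open import Relation.Binary.Reasoning.Setoid setoid

  inFq : ∀ {s} → s ^ q ≈ s → InFq q s
  inFq {s} = trans (reflexive (pow≡^ s q))

  pow-2 : ∀ x → x * x ≈ pow x 2
  pow-2 x = *-congˡ (sym (*-identityʳ x))

  pow-[q+1] : ∀ x → x * x ^ q ≈ pow x (suc q)
  pow-[q+1] x = *-congˡ (reflexive (≡.sym (pow≡^ x q)))

  single-nonZero : ∀ {a b s x u} → NonZeroPair a b →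
    a ≈ s * (x * x) → b ≈ s * (u * (x * x ^ q)) → ¬ s ≈ 0# × ¬ x ≈ 0#
  single-nonZero {s = s} {x} {u} ab≉0 a≈ b≈ =
    (λ s≈0 → ab≉0 (trans a≈ (trans (*-congʳ s≈0) (zeroˡ _)) , trans b≈ (trans (*-congʳ s≈0) (zeroˡ _)))) ,
    (λ x≈0 → ab≉0
      ( trans a≈ (trans (*-congˡ (trans (*-congʳ x≈0) (zeroˡ _))) (zeroʳ s))
      , trans b≈ (trans (*-congˡ (trans (*-congˡ (trans (*-congʳ x≈0) (zeroˡ _))) (zeroʳ u))) (zeroʳ s))))

  inV : ∀ {a b s x ω} → NonZeroPair a b → s ^ q ≈ s →
    a ≈ s * (x * x) → b ≈ s * (ω * (x * x ^ q)) → InV q ω a b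
  inV {s = s} {x} ab≉0 s∈Fq a≈ b≈ with single-nonZero ab≉0 a≈ b≈
  ... | s≉0 , x≉0 = x , s , x≉0 , inFq s∈Fq , s≉0 ,
    trans a≈ (*-congˡ (pow-2 x)) , trans b≈ (*-congˡ (*-congˡ (pow-[q+1] x)))

  -- A solution with x = 0 places the point on V_α, one with y = 0 on V_1, the remaining coefficient
  -- being non-zero because (a , b) is. Away from both varieties x and y are therefore non-zero.
  onSecant : ∀ {a b} → NonZeroPair a b → ¬ InV q 1# a b → ¬ InV q α a b → Represents a b → OnSecant q α a b
  onSecant {a} {b} ab≉0 ∉V₁ ∉Vα rep with x ≟ 0# | y ≟ 0#
    where open Represents rep
  ... | yes x≈0 | _ = ⊥-elim (∉Vα (inV ab≉0 t∈Fq
    (trans a≈ (vanish (*-congʳ x≈0))) (trans b≈ (vanish (*-congʳ x≈0)))))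
    where
    open Represents rep
    vanish : ∀ {u v w} → u ≈ 0# * v → s * u + w ≈ w
    vanish u≈0 = trans (+-congʳ (trans (*-congˡ (trans u≈0 (zeroˡ _))) (zeroʳ s))) (+-identityˡ _)
  ... | no _ | yes y≈0 = ⊥-elim (∉V₁ (inV ab≉0 s∈Fq
    (trans a≈ (vanish (trans (*-congʳ y≈0) (zeroˡ _))))
    (trans (trans b≈ (vanish (trans (*-congˡ (trans (*-congʳ y≈0) (zeroˡ _))) (zeroʳ α)))) (*-congˡ (sym (*-identityˡ _))))))
    where
    open Represents rep
    vanish : ∀ {u w} → u ≈ 0# → w + t * u ≈ w
    vanish u≈0 = trans (+-congˡ (trans (*-congˡ u≈0) (zeroʳ t))) (+-identityʳ _)
  ... | no x≉0 | no y≉0 = x , y , s , t , x≉0 , y≉0 , inFq s∈Fq , inFq t∈Fq ,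
    trans a≈ (+-cong (*-congˡ (pow-2 x)) (*-congˡ (pow-2 y))) ,
    trans b≈ (+-cong (*-congˡ (pow-[q+1] x)) (*-congˡ (*-congˡ (pow-[q+1] y))))
    where open Represents rep

-- Arithmetic of the exponents and assembly of the two cases

open import Data.Nat using (_>_; _+_; _*_; _^_; _%_; _/_)

2n+3 : ∀ n → 2 * suc n + 1 ≡ 2 + (2 * n + 1)
2n+3 = ℕ-Ring.solve-∀

-- For the base B = `suc q`, B² Q + 1 = (Q + 1) + (B + 1)(B - 1) Q; naming the predecessor of B
-- avoids subtraction.
q+1∣q^[2n+1]+1 : ∀ q n → ∃ λ M → 1 + (suc q) ^ (2 * n + 1) ≡ (1 + suc q) * M
q+1∣q^[2n+1]+1 q zero = 1 , base q
  where
  base : ∀ q → 1 + suc q * 1 ≡ (1 + suc q) * 1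
  base = ℕ-Ring.solve-∀
q+1∣q^[2n+1]+1 q (suc n) with q+1∣q^[2n+1]+1 q n
... | M , eq = M + q * Q , (begin
  1 + suc q ^ (2 * suc n + 1)           ≡⟨ ≡.cong (λ m → 1 + suc q ^ m) (2n+3 n) ⟩
  1 + suc q * (suc q * Q)               ≡⟨ split q Q ⟩
  (1 + Q) + (1 + suc q) * (q * Q)       ≡⟨ ≡.cong (_+ (1 + suc q) * (q * Q)) eq ⟩
  (1 + suc q) * M + (1 + suc q) * (q * Q) ≡⟨ ℕ.*-distribˡ-+ (1 + suc q) M (q * Q) ⟨
  (1 + suc q) * (M + q * Q)             ∎)
  where
  open ≡.≡-Reasoning
  Q = suc q ^ (2 * n + 1)
  split : ∀ q Q → 1 + suc q * (suc q * Q) ≡ (1 + Q) + (1 + suc q) * (q * Q)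
  split = ℕ-Ring.solve-∀

-- (Q - 1) / (q - 1) is odd, for q = 2 r + 3 and Q = q^(2n+1).
[Q-1]/[q-1]-odd : ∀ r n → ∃ λ l → (1 + 2 * suc r) ^ (2 * n + 1) ≡ 1 + 2 * suc (2 * l + r * (1 + 2 * l))
[Q-1]/[q-1]-odd r zero = 0 , base r
  where
  base : ∀ r → (1 + 2 * suc r) * 1 ≡ 1 + 2 * suc (2 * 0 + r * (1 + 2 * 0))
  base = ℕ-Ring.solve-∀
[Q-1]/[q-1]-odd r (suc n) with [Q-1]/[q-1]-odd r n
-- The quotient L = 1 + 2 l becomes q² L + q + 1, so l becomes q² l + (q² + q) / 2, and the last
-- fraction is evaluated at q = 1 + 2 (r + 1).
... | l , eq = q * q * l + (1 + 3 * suc r + 2 * (suc r * suc r)) , (begin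
  q ^ (2 * suc n + 1)                                     ≡⟨ ≡.cong (q ^_) (2n+3 n) ⟩
  q * (q * q ^ (2 * n + 1))                               ≡⟨ ≡.cong (λ m → q * (q * m)) eq ⟩
  q * (q * (1 + 2 * suc (2 * l + r * (1 + 2 * l))))       ≡⟨ step r l ⟩
  1 + 2 * suc (2 * l′ + r * (1 + 2 * l′))                 ∎)
  where
  open ≡.≡-Reasoning
  q = 1 + 2 * suc r
  l′ = q * q * l + (1 + 3 * suc r + 2 * (suc r * suc r))
  step : ∀ r l → (1 + 2 * suc r) * ((1 + 2 * suc r) * (1 + 2 * suc (2 * l + r * (1 + 2 * l))))
    ≡ 1 + 2 * suc (2 * ((1 + 2 * suc r) * (1 + 2 * suc r) * l + (1 + 3 * suc r + 2 * (suc r * suc r)))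
        + r * (1 + 2 * ((1 + 2 * suc r) * (1 + 2 * suc r) * l + (1 + 3 * suc r + 2 * (suc r * suc r)))))
  step = ℕ-Ring.solve-∀

2∣p^k⇒p≡2 : ∀ {p} k → Prime p → 2 ∣ p ^ k → p ≡ 2
2∣p^k⇒p≡2 zero p-prime (divides zero ())
2∣p^k⇒p≡2 zero p-prime (divides (suc d) ())
2∣p^k⇒p≡2 {p} (suc k) p-prime 2∣p^k with euclidsLemma p (p ^ k) prime[2] 2∣p^k
... | inj₂ 2∣p^k′ = 2∣p^k⇒p≡2 k p-prime 2∣p^k′
... | inj₁ 2∣p with prime⇒irreducible p-prime 2∣p
...   | inj₁ ()
...   | inj₂ 2≡p = ≡.sym 2≡p

odd>2⇒2r+3 : ∀ {q} → q % 2 ≡ 1 → q > 2 → ∃ λ r → q ≡ 1 + 2 * suc r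
odd>2⇒2r+3 {q} q%2≡1 q>2 with q / 2 | ≡.trans (m≡m%n+[m/n]*n q 2) (≡.cong (_+ q / 2 * 2) q%2≡1)
... | zero  | ≡.refl = ⊥-elim (ℕ.<-asym q>2 (ℕ.s<s ℕ.z<s))
... | suc r | eq = r , ≡.trans eq (≡.cong suc (ℕ.*-comm (suc r) 2))

theorem3p6 : ∀ {c ℓ : Level} (q n : ℕ) → IsPrimePower q → q > 2 → n > 0 →
    (K : Field c ℓ) → FieldDefs.HasCardinality K (q ^ (2 * n + 1)) →
    (α : Field.Carrier K) →
    ((q % 2 ≡ 1 × Field._≈_ K α (Field.-_ K (Field.1# K)))
    ⊎ (q % 2 ≡ 0 × FieldDefs.InFq K q α × ¬ Field._≈_ K α (Field.0# K)
    × ¬ Field._≈_ K α (Field.1# K))) →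
    ∀ (a b : Field.Carrier K) → FieldDefs.NonZeroPair K a b →
    ¬ FieldDefs.InV K q (Field.1# K) a b → ¬ FieldDefs.InV K q α a b →
    FieldDefs.OnSecant K q α a b
theorem3p6 zero n _ ()
theorem3p6 q@(suc q₁) n (p , k , p-prime , q≡p^k) q>2 n>0 K card α α-cases a b ab≉0 ∉V₁ ∉Vα =
  Secants.onSecant K q (q ^ (2 * n + 1)) card α ab≉0 ∉V₁ ∉Vα (represents α-cases)
  where
  open Field K using (_≈_; 0#; 1#; trans; sym; +-congˡ; *-congˡ; *-congʳ) renaming (-_ to -ᶠ_)
  open Representation K q
  M = proj₁ (q+1∣q^[2n+1]+1 q₁ n)
  Q+1≡[q+1]M = proj₂ (q+1∣q^[2n+1]+1 q₁ n)

  Q≡p^ : q ^ (2 * n + 1) ≡ p ^ (suc k * (2 * n + 1))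
  Q≡p^ = ≡.trans (≡.cong (_^ (2 * n + 1)) q≡p^k) (ℕ.^-*-assoc p (suc k) (2 * n + 1))

  represents : (q % 2 ≡ 1 × α ≈ -ᶠ 1#) ⊎ (q % 2 ≡ 0 × FieldDefs.InFq K q α × ¬ α ≈ 0# × ¬ α ≈ 1#) →
    Represents α a b
  represents (inj₁ (q%2≡1 , α≈-1)) with odd>2⇒2r+3 q%2≡1 q>2
  ... | r , ≡.refl with [Q-1]/[q-1]-odd r n
  ... | l , Q≡ = record
    { x = x ; y = y ; s = s ; t = t ; s∈Fq = s∈Fq ; t∈Fq = t∈Fq ; a≈ = a≈
    ; b≈ = trans b≈ (+-congˡ (*-congˡ (*-congʳ (sym α≈-1)))) }
    where
    open Represents (-ᶠ 1#) (OddOrder.represents K r l M (≡.subst (FieldDefs.HasCardinality K) Q≡ card)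
      p (suc k) (suc k * (2 * n + 1)) p-prime q≡p^k (≡.trans (≡.sym Q≡) Q≡p^)
      (≡.trans (≡.cong suc (≡.sym Q≡)) Q+1≡[q+1]M) a b ab≉0)
  represents (inj₂ (q%2≡0 , α∈Fq , _ , α≉1)) with 2∣q
    where
    2∣q : 2 ∣ q
    2∣q = divides (q / 2) (≡.trans (m≡m%n+[m/n]*n q 2) (≡.cong (_+ q / 2 * 2) q%2≡0))
  ... | 2∣q with 2∣p^k⇒p≡2 (suc k) p-prime (≡.subst (2 ∣_) q≡p^k 2∣q)
  ... | ≡.refl = EvenOrder.represents K q H M (≡.subst (FieldDefs.HasCardinality K) Q≡2H card)
    (suc k) (suc k * (2 * n + 1)) q≡p^k (≡.trans (≡.sym Q≡2H) Q≡p^)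
    (≡.trans (≡.cong suc (≡.sym Q≡2H)) Q+1≡[q+1]M) α α∈Fq α≉1 a b
    where
    -- With p = 2 the order of F is 2 to the power (k + 1)(2 n + 1); one factor 2 is split off, so
    -- that the `H`-th power is the square root.
    H = 2 ^ (k + suc k * (2 * n))
    Q≡2H : q ^ (2 * n + 1) ≡ 2 * H
    Q≡2H = ≡.trans Q≡p^ (≡.cong (2 ^_) (exponent k n))
      where
      exponent : ∀ k n → suc k * (2 * n + 1) ≡ suc (k + suc k * (2 * n))
      exponent = ℕ-Ring.solve-∀
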